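{- The model $\mathscr{D}$ is fully abstract for PCF, i.e. for all PCF programs (closed PCF terms) $P,P'$ of type $\alpha$: $\mathcal{I}_\alpha(P)=\mathcal{I}_\alpha(P')$ if and only if $P\equiv_{\mathrm{obs}}P'$.
   Context: PCF is Plotkin's language (call-by-name weak head reduction $\to_{\sf PCF}$, simple types over the ground type $\mathsf{int}$). Observational equivalence: $P\equiv_{\mathrm{obs}}P'$ iff for every PCF context $C[\cdot]$ of result type $\mathsf{int}$ (closing both), $C[P]\twoheadrightarrow_{\sf PCF}\underline n \iff C[P']\twoheadrightarrow_{\sf PCF}\underline n$. Extended addressing machines (EAMs) are tuples $\langle R_0,\dots,R_r,P,T\rangle$ (registers, program, input tape of addresses) over a countable set $\mathbb{A}$ of addresses containing $\mathbb{N}$; a bijective address table map $\#$ assigns an address to every EAM, with $\#(\mathsf{n})=n$ for the numeral machine $\mathsf n$; $\mathsf M@[a_1,\dots,a_k]$ appends $a_1,\dots,a_k$ to the tape of $\mathsf M$, and application of addresses is $a\cdot b=\#(\#^{ -1}(a)@[b])$. EAMs have a deterministic reduction $\to_{\mathsf c}$ and a simple type system with judgements $\mathsf M:\alpha$. There is a compositional translation $\mathrm{Tr}_{\vec x}(M)$ sending each PCF (or EPCF, i.e. PCF with closed explicit substitutions) term with free variables among $\vec x=x_1,\dots,x_n$ to an EAM that reads the values of $x_1,\dots,x_n$ from its input tape ($\mathrm{Tr}(M)$ for $n=0$); it is type-preserving. Let $\mathcal D_\alpha=\{a\in\mathbb A\mid \#^{ -1}(a):\alpha\}$ and define the logical relation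 on EAMs of type $\alpha$: $\mathsf M\equiv_{\mathsf{int}}\mathsf N$ iff for all $n$, $\mathsf M\twoheadrightarrow_{\mathsf c}\mathsf n\iff \mathsf N\twoheadrightarrow_{\mathsf c}\mathsf n$; $\mathsf M\equiv_{\alpha\to\beta}\mathsf N$ iff for all $a,b\in\mathcal D_\alpha$ with $\#^{ -1}(a)\equiv_\alpha\#^{ -1}(b)$, $\mathsf M@[a]\equiv_\beta \mathsf N@[b]$; write $a\simeq_\alpha b$ for $\#^{ -1}(a)\equiv_\alpha\#^{ -1}(b)$. The model $\mathscr{D}$ has carriers $\mathcal D_\alpha/{\simeq_\alpha}$, application $[a]\cdot[b]=[a\cdot b]$, and interpretation $\mathcal{I}_{\beta_1\to\cdots\to\beta_n\to\alpha}(x_1{:}\beta_1,\dots,x_n{:}\beta_n\vdash P:\alpha)=[\#\mathrm{Tr}_{\vec x}(P)]_{\simeq_{\beta_1\to\cdots\to\beta_n\to\alpha}}$; for closed $P$ of type $\alpha$ this is $\mathcal I_\alpha(P)=[\#\mathrm{Tr}(P)]_{\simeq_\alpha}$. -}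

module Defs where

open import Data.Nat using (ℕ; zero; suc; _∸_; _≡ᵇ_)
open import Data.Bool using (Bool; true; false; if_then_else_)
open import Data.List using (List; []; _∷_; _++_; length; replicate)
open import Data.Maybe using (Maybe; just; nothing)
open import Data.Product using (_×_; _,_)
open import Relation.Binary.PropositionalEquality using (_≡_)
open import Relation.Binary.Construct.Closure.ReflexiveTransitive using (Star)

_‼_ : ∀ {A : Set} → List A → ℕ → Maybe A
[] ‼ _ = nothing
(x ∷ xs) ‼ zero = just x
(x ∷ xs) ‼ suc i = xs ‼ i

_[_≔_] : ∀ {A : Set} → List A → ℕ → A → List A
[] [ _ ≔ _ ] = []
(x ∷ xs) [ zero ≔ y ] = y ∷ xs
(x ∷ xs) [ suc i ≔ y ] = x ∷ (xs [ i ≔ y ])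

-- Maybe-valued slot lookup (a register that is absent or uninitialised gives nothing)
slot : ∀ {A : Set} → List (Maybe A) → ℕ → Maybe A
slot R i with R ‼ i
... | just m = m
... | nothing = nothing

range : ℕ → ℕ → List ℕ
range b zero = []
range b (suc n) = b ∷ range (suc b) n

infixr 30 _⇒_
data Ty : Set where
  int : Ty
  _⇒_ : Ty → Ty → Ty

_⇛_ : List Ty → Ty → Ty
[] ⇛ α = α
(τ ∷ τs) ⇛ α = τ ⇒ (τs ⇛ α)

data Term : Set where
  var  : ℕ → Term
  lam  : ℕ → Ty → Term → Term
  _·_  : Term → Term → Term
  num  : ℕ → Term
  pred : Term → Term
  succ : Term → Term
  ifz  : Term → Term → Term → Term
  fix  : Term → Term

-- typing contexts: newest binding first
TCtx : Set
TCtx = List (ℕ × Ty)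

lookupT : TCtx → ℕ → Maybe Ty
lookupT [] x = nothing
lookupT ((y , σ) ∷ Γ) x = if x ≡ᵇ y then just σ else lookupT Γ x

infix 4 _⊢_∶_
data _⊢_∶_ : TCtx → Term → Ty → Set where
  tvar  : ∀ {Γ x α} → lookupT Γ x ≡ just α → Γ ⊢ var x ∶ α
  tlam  : ∀ {Γ x σ M τ} → ((x , σ) ∷ Γ) ⊢ M ∶ τ → Γ ⊢ lam x σ M ∶ σ ⇒ τ
  tapp  : ∀ {Γ M N σ τ} → Γ ⊢ M ∶ σ ⇒ τ → Γ ⊢ N ∶ σ → Γ ⊢ M · N ∶ τ
  tnum  : ∀ {Γ n} → Γ ⊢ num n ∶ int
  tpred : ∀ {Γ M} → Γ ⊢ M ∶ int → Γ ⊢ pred M ∶ int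
  tsucc : ∀ {Γ M} → Γ ⊢ M ∶ int → Γ ⊢ succ M ∶ int
  tifz  : ∀ {Γ L M N} → Γ ⊢ L ∶ int → Γ ⊢ M ∶ int → Γ ⊢ N ∶ int → Γ ⊢ ifz L M N ∶ int
  tfix  : ∀ {Γ M α} → Γ ⊢ M ∶ α ⇒ α → Γ ⊢ fix M ∶ α

-- substitution M[N/x]; only ever used with N closed (weak reduction of programs),
-- so no capture can occur
_[_/_] : Term → Term → ℕ → Term
var y [ N / x ] = if y ≡ᵇ x then N else var y
lam y σ M [ N / x ] = if y ≡ᵇ x then lam y σ M else lam y σ (M [ N / x ])
(M₁ · M₂) [ N / x ] = (M₁ [ N / x ]) · (M₂ [ N / x ])
num n [ N / x ] = num n
pred M [ N / x ] = pred (M [ N / x ])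
succ M [ N / x ] = succ (M [ N / x ])
ifz L M P [ N / x ] = ifz (L [ N / x ]) (M [ N / x ]) (P [ N / x ])
fix M [ N / x ] = fix (M [ N / x ])

infix 4 _→PCF_
data _→PCF_ : Term → Term → Set where
  beta   : ∀ {x σ M N} → (lam x σ M · N) →PCF (M [ N / x ])
  fixβ   : ∀ {M} → fix M →PCF (M · fix M)
  pred0  : pred (num 0) →PCF num 0
  predS  : ∀ {n} → pred (num (suc n)) →PCF num n
  succN  : ∀ {n} → succ (num n) →PCF num (suc n)
  ifz0   : ∀ {M N} → ifz (num 0) M N →PCF M
  ifzS   : ∀ {n M N} → ifz (num (suc n)) M N →PCF N
  appL   : ∀ {M M' N} → M →PCF M' → (M · N) →PCF (M' · N)
  predC  : ∀ {M M'} → M →PCF M' → pred M →PCF pred M'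
  succC  : ∀ {M M'} → M →PCF M' → succ M →PCF succ M'
  ifzC   : ∀ {L L' M N} → L →PCF L' → ifz L M N →PCF ifz L' M N

infix 4 _↠PCF_
_↠PCF_ : Term → Term → Set
_↠PCF_ = Star _→PCF_

-- PCF contexts with one hole (binders of the context may capture)
data Context : Set where
  hole  : Context
  lamC  : ℕ → Ty → Context → Context
  appCL : Context → Term → Context
  appCR : Term → Context → Context
  predC : Context → Context
  succC : Context → Context
  ifzC₁ : Context → Term → Term → Context
  ifzC₂ : Term → Context → Term → Context
  ifzC₃ : Term → Term → Context → Context
  fixC  : Context → Context

plug : Context → Term → Term
plug hole P = P
plug (lamC x σ C) P = lam x σ (plug C P)
plug (appCL C N) P = plug C P · N
plug (appCR M C) P = M · plug C P
plug (predC C) P = pred (plug C P)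
plug (succC C) P = succ (plug C P)
plug (ifzC₁ C M N) P = ifz (plug C P) M N
plug (ifzC₂ L C N) P = ifz L (plug C P) N
plug (ifzC₃ L M C) P = ifz L M (plug C P)
plug (fixC C) P = fix (plug C P)

_≡obs_ : Term → Term → Set
P ≡obs P' = ∀ (C : Context) → [] ⊢ plug C P ∶ int → [] ⊢ plug C P' ∶ int →
  ∀ (n : ℕ) → ((plug C P ↠PCF num n) → (plug C P' ↠PCF num n))
            × ((plug C P' ↠PCF num n) → (plug C P ↠PCF num n))

data Act : Set where
  App  : ℕ → ℕ → ℕ → Act → Act
  Pred : ℕ → ℕ → Act → Act
  Succ : ℕ → ℕ → Act → Act
  Ifz  : ℕ → ℕ → ℕ → ℕ → Act → Act
  Call : ℕ → Act

data Prog : Set where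
  Load : ℕ → Prog → Prog
  act  : Act → Prog

-- a machine is a numeral n, or ⟨R₀,…,Rᵣ,P,T⟩ (registers possibly uninitialised)
data EAM (𝔸 : Set) : Set where
  numeral : ℕ → EAM 𝔸
  ⟨_,_,_⟩ : List (Maybe 𝔸) → Prog → List 𝔸 → EAM 𝔸

_⊲_ : ∀ {𝔸 : Set} → EAM 𝔸 → List 𝔸 → EAM 𝔸
numeral n ⊲ T' = numeral n
⟨ R , P , T ⟩ ⊲ T' = ⟨ R , P , T ++ T' ⟩

-- the fixed point machine Y of the reflection principle, given its own address y:
-- Y ⊲ [f] ↠ #⁻¹(f) ⊲ [#(Y ⊲ [f])]
Yregs : ∀ {𝔸 : Set} → 𝔸 → List (Maybe 𝔸)
Yregs y = just y ∷ nothing ∷ []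

Yprog : Prog
Yprog = Load 1 (act (App 0 1 0 (App 1 0 0 (Call 0))))

-- Address table: 𝔸 countable, ℕ ⊆ 𝔸 via num, # : EAM → 𝔸 bijective with #(n) = n,
-- plus the reflection principle (an address y of the machine Y that contains y).
record AddressTable (𝔸 : Set) (num𝔸 : ℕ → 𝔸) : Set where
  field
    #     : EAM 𝔸 → 𝔸
    #⁻¹   : 𝔸 → EAM 𝔸
    #⁻¹#  : ∀ M → #⁻¹ (# M) ≡ M
    ##⁻¹  : ∀ a → # (#⁻¹ a) ≡ a
    #num  : ∀ n → # (numeral n) ≡ num𝔸 n
    enc   : 𝔸 → ℕ
    enc-injective : ∀ a b → enc a ≡ enc b → a ≡ b
    y     : 𝔸
    #⁻¹y  : #⁻¹ y ≡ ⟨ Yregs y , Yprog , [] ⟩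

module _ {𝔸 : Set} {num𝔸 : ℕ → 𝔸} (tbl : AddressTable 𝔸 num𝔸) where
  open AddressTable tbl

  _·ᴬ_ : 𝔸 → 𝔸 → 𝔸
  a ·ᴬ b = # (#⁻¹ a ⊲ (b ∷ []))

  infix 4 _→c_
  data _→c_ : EAM 𝔸 → EAM 𝔸 → Set where
    load  : ∀ {R i P a T} → ⟨ R , Load i P , a ∷ T ⟩ →c ⟨ R [ i ≔ just a ] , P , T ⟩
    app   : ∀ {R i j k A T a b} → slot R i ≡ just a → slot R j ≡ just b →
            ⟨ R , act (App i j k A) , T ⟩ →c ⟨ R [ k ≔ just (a ·ᴬ b) ] , act A , T ⟩
    predN : ∀ {R i j A T a n} → slot R i ≡ just a → #⁻¹ a ≡ numeral n →
            ⟨ R , act (Pred i j A) , T ⟩ →c ⟨ R [ j ≔ just (num𝔸 (n ∸ 1)) ] , act A , T ⟩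
    predR : ∀ {R i j A T a M'} → slot R i ≡ just a → #⁻¹ a →c M' →
            ⟨ R , act (Pred i j A) , T ⟩ →c ⟨ R [ i ≔ just (# M') ] , act (Pred i j A) , T ⟩
    succN : ∀ {R i j A T a n} → slot R i ≡ just a → #⁻¹ a ≡ numeral n →
            ⟨ R , act (Succ i j A) , T ⟩ →c ⟨ R [ j ≔ just (num𝔸 (suc n)) ] , act A , T ⟩
    succR : ∀ {R i j A T a M'} → slot R i ≡ just a → #⁻¹ a →c M' →
            ⟨ R , act (Succ i j A) , T ⟩ →c ⟨ R [ i ≔ just (# M') ] , act (Succ i j A) , T ⟩
    ifz0  : ∀ {R i j k l A T a b} → slot R i ≡ just a → #⁻¹ a ≡ numeral 0 → slot R j ≡ just b →
            ⟨ R , act (Ifz i j k l A) , T ⟩ →c ⟨ R [ l ≔ just b ] , act A , T ⟩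
    ifzS  : ∀ {R i j k l A T a n c} → slot R i ≡ just a → #⁻¹ a ≡ numeral (suc n) → slot R k ≡ just c →
            ⟨ R , act (Ifz i j k l A) , T ⟩ →c ⟨ R [ l ≔ just c ] , act A , T ⟩
    ifzR  : ∀ {R i j k l A T a M'} → slot R i ≡ just a → #⁻¹ a →c M' →
            ⟨ R , act (Ifz i j k l A) , T ⟩ →c ⟨ R [ i ≔ just (# M') ] , act (Ifz i j k l A) , T ⟩
    call  : ∀ {R i T a} → slot R i ≡ just a →
            ⟨ R , act (Call i) , T ⟩ →c (#⁻¹ a ⊲ T)

  infix 4 _↠c_
  _↠c_ : EAM 𝔸 → EAM 𝔸 → Set
  _↠c_ = Star _→c_

  -- register typings: Δ i = just τ for an initialised register of type τ
  RTy : Set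
  RTy = List (Maybe Ty)

  infix 4 _⊢ᴬ_∶_ _⊢ᴾ_∶_
  data _⊢ᴬ_∶_ : RTy → Act → Ty → Set where
    tApp  : ∀ {Δ i j k A τ ρ σ} → slot Δ i ≡ just (τ ⇒ ρ) → slot Δ j ≡ just τ →
            (Δ [ k ≔ just ρ ]) ⊢ᴬ A ∶ σ → Δ ⊢ᴬ App i j k A ∶ σ
    tPred : ∀ {Δ i j A σ} → slot Δ i ≡ just int → (Δ [ j ≔ just int ]) ⊢ᴬ A ∶ σ →
            Δ ⊢ᴬ Pred i j A ∶ σ
    tSucc : ∀ {Δ i j A σ} → slot Δ i ≡ just int → (Δ [ j ≔ just int ]) ⊢ᴬ A ∶ σ →
            Δ ⊢ᴬ Succ i j A ∶ σ
    tIfz  : ∀ {Δ i j k l A σ} → slot Δ i ≡ just int → slot Δ j ≡ just int →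
            slot Δ k ≡ just int → (Δ [ l ≔ just int ]) ⊢ᴬ A ∶ σ → Δ ⊢ᴬ Ifz i j k l A ∶ σ
    tCall : ∀ {Δ i σ} → slot Δ i ≡ just σ → Δ ⊢ᴬ Call i ∶ σ

  data _⊢ᴾ_∶_ : RTy → Prog → Ty → Set where
    tLoad : ∀ {Δ i P τ σ} → (Δ [ i ≔ just τ ]) ⊢ᴾ P ∶ σ → Δ ⊢ᴾ Load i P ∶ τ ⇒ σ
    tAct  : ∀ {Δ A σ} → Δ ⊢ᴬ A ∶ σ → Δ ⊢ᴾ act A ∶ σ

  mutual
    infix 4 _∶ᴹ_
    data _∶ᴹ_ : EAM 𝔸 → Ty → Set where
      tNum  : ∀ {n} → numeral n ∶ᴹ int
      tMach : ∀ {R P T Δ τs α} → RegsTy Δ R → Δ ⊢ᴾ P ∶ (τs ⇛ α) → TapeTy T τs →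
              ⟨ R , P , T ⟩ ∶ᴹ α
      tY    : ∀ {T τs α β} → ((α ⇒ α) ⇒ α) ≡ (τs ⇛ β) → TapeTy T τs →
              ⟨ Yregs y , Yprog , T ⟩ ∶ᴹ β

    data RegsTy : RTy → List (Maybe 𝔸) → Set where
      []  : RegsTy [] []
      ∅∷_ : ∀ {Δ R} → RegsTy Δ R → RegsTy (nothing ∷ Δ) (nothing ∷ R)
      _∷ᵗ_ : ∀ {Δ R a τ} → #⁻¹ a ∶ᴹ τ → RegsTy Δ R → RegsTy (just τ ∷ Δ) (just a ∷ R)

    data TapeTy : List 𝔸 → List Ty → Set where
      []  : TapeTy [] []
      _∷_ : ∀ {T τs a τ} → #⁻¹ a ∶ᴹ τ → TapeTy T τs → TapeTy (a ∷ T) (τ ∷ τs)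

  𝒟 : Ty → 𝔸 → Set
  𝒟 α a = #⁻¹ a ∶ᴹ α

  _≡[_]_ : EAM 𝔸 → Ty → EAM 𝔸 → Set
  M ≡[ int ] N = ∀ (n : ℕ) → ((M ↠c numeral n) → (N ↠c numeral n))
                           × ((N ↠c numeral n) → (M ↠c numeral n))
  M ≡[ α ⇒ β ] N = ∀ (a b : 𝔸) → 𝒟 α a → 𝒟 α b → (#⁻¹ a ≡[ α ] #⁻¹ b) →
                   (M ⊲ (a ∷ [])) ≡[ β ] (N ⊲ (b ∷ []))

  _≃[_]_ : 𝔸 → Ty → 𝔸 → Set
  a ≃[ α ] b = #⁻¹ a ≡[ α ] #⁻¹ b

  -- translation Tr_{x⃗}(M)  (x⃗ in binding order: the tape supplies x₁,…,xₙ)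

  -- index of the last (innermost) occurrence of x in xs
  lastIndex : List ℕ → ℕ → Maybe ℕ
  lastIndex [] x = nothing
  lastIndex (z ∷ zs) x with lastIndex zs x
  ... | just i = just (suc i)
  ... | nothing = if x ≡ᵇ z then just zero else nothing

  loads : List ℕ → Act → Prog
  loads [] A = act A
  loads (i ∷ is) A = Load i (loads is A)

  apps : ℕ → List ℕ → Act → Act
  apps r [] A = A
  apps r (i ∷ is) A = App r i r (apps r is A)

  empties : ℕ → List (Maybe 𝔸)
  empties n = replicate n nothing

  Tr : List ℕ → Term → EAM 𝔸
  Tr xs (var x) with lastIndex xs x
  ... | just i = ⟨ empties (length xs) , loads (range 0 (length xs)) (Call i) , [] ⟩
  ... | nothing = ⟨ empties (length xs) , loads (range 0 (length xs)) (Call (length xs)) , [] ⟩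
  Tr xs (lam x σ M) = Tr (xs ++ (x ∷ [])) M
  Tr xs (M · N) =
    ⟨ just (# (Tr xs M)) ∷ just (# (Tr xs N)) ∷ empties (length xs)
    , loads (range 2 (length xs))
        (apps 0 (range 2 (length xs)) (apps 1 (range 2 (length xs)) (App 0 1 0 (Call 0))))
    , [] ⟩
  Tr xs (num n) =
    ⟨ just (num𝔸 n) ∷ empties (length xs) , loads (range 1 (length xs)) (Call 0) , [] ⟩
  Tr xs (pred M) =
    ⟨ just (# (Tr xs M)) ∷ empties (length xs)
    , loads (range 1 (length xs)) (apps 0 (range 1 (length xs)) (Pred 0 0 (Call 0))) , [] ⟩
  Tr xs (succ M) =
    ⟨ just (# (Tr xs M)) ∷ empties (length xs)
    , loads (range 1 (length xs)) (apps 0 (range 1 (length xs)) (Succ 0 0 (Call 0))) , [] ⟩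
  Tr xs (ifz L M N) =
    ⟨ just (# (Tr xs L)) ∷ just (# (Tr xs M)) ∷ just (# (Tr xs N)) ∷ empties (length xs)
    , loads (range 3 (length xs))
        (apps 0 (range 3 (length xs)) (apps 1 (range 3 (length xs))
          (apps 2 (range 3 (length xs)) (Ifz 0 1 2 0 (Call 0)))))
    , [] ⟩
  Tr xs (fix M) =
    ⟨ just y ∷ just (# (Tr xs M)) ∷ empties (length xs)
    , loads (range 2 (length xs)) (apps 1 (range 2 (length xs)) (App 0 1 0 (Call 0))) , [] ⟩

  -- the model 𝒟: carrier 𝒟_α/≃_α; classes are compared through ≃_α

  -- representative of 𝓘_α(P) = [#Tr(P)]
  𝓘 : Term → 𝔸
  𝓘 P = # (Tr [] P)

  -- equality of equivalence classes in 𝒟_α/≃_α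
  _=[_]_ : 𝔸 → Ty → 𝔸 → Set
  a =[ α ] b = a ≃[ α ] b

{-# OPTIONS --safe #-}
module Submission where

-- Machines and closed PCF terms are two deterministic applicative systems, compared by a directed
-- step-indexed logical relation: at type int, convergence of the left side in fewer than k steps
-- forces convergence of the right side to the same numeral. The index makes fixed points a plain
-- induction on k. Three comparisons are needed. A typed machine is related to itself, so that ≃ is
-- reflexive on 𝒟. A PCF term is related, in both directions, to its translation; at type int this
-- is adequacy. A typed machine is related, in both directions, to a PCF term read off its typing
-- derivation (registers become variables), so every argument that ≃ quantifies over is definable.
-- Hence ≃ implies ≡obs because C[P] computes like Tr(λz.C[z]) applied to #Tr(P) and the machine
-- Tr(λz.C[z]) respects ≃; conversely, observationally equivalent terms are applied to the terms
-- that define the arguments, down to type int.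

open import Defs
open import Data.Bool using (T; true; false; if_then_else_)
open import Data.List using (List; []; _∷_; _++_; length; map; replicate)
open import Data.List.Properties using (++-assoc; ++-identityʳ; length-++; length-map; length-replicate)
open import Data.Maybe using (Maybe; just; nothing; fromMaybe)
open import Data.Maybe.Properties using (just-injective)
open import Data.Nat using (ℕ; zero; suc; _+_; _∸_; _≡ᵇ_; _≤_; _<_; _⊔_; z≤n; s≤s)
open import Data.Nat.Properties
open import Data.Product using (∃; ∃₂; _×_; _,_; proj₁; proj₂)
open import Data.Sum using (_⊎_; inj₁; inj₂)
open import Function using (_∘_; id)
open import Relation.Binary.Construct.Closure.ReflexiveTransitive using (Star; ε; _◅_; _◅◅_; gmap)
open import Relation.Binary.PropositionalEquality
open import Relation.Nullary using (¬_; contradiction)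

-- The index of `Rel` counts steps of the left side only, so the two sides may run at unrelated
-- speeds; the price is that an equivalence takes two relations, one in each direction. Hence each
-- comparison is proved once, for two arbitrary instances of `World`, and then instantiated in the
-- directions required. Three mismatches shape the rest. The machine Y holds its own address, so
-- reading its registers as terms would never end; it is typed by the separate rule `tY` and read as
-- `λf. fix f`. A machine tests a register at any result type and overwrites it with the value,
-- while `ifz` lives at type `int` and PCF has no store: in PCF a test is delayed until all
-- arguments are present, and the operand is evaluated again afterwards. Finally, `≃` feeds
-- different, merely equivalent, arguments to the two machines, whereas a PCF context gives the same
-- term to both sides; the second argument is reached only because a typed machine respects `≃`.

data Iter {A : Set} (_⟶_ : A → A → Set) : ℕ → A → A → Set where
  done : ∀ {x} → Iter _⟶_ zero x x
  step : ∀ {k x y z} → x ⟶ y → Iter _⟶_ k y z → Iter _⟶_ (suc k) x z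

module _ {A : Set} {_⟶_ : A → A → Set} where
  Iter⇒Star : ∀ {k x y} → Iter _⟶_ k x y → Star _⟶_ x y
  Iter⇒Star done = ε
  Iter⇒Star (step s r) = s ◅ Iter⇒Star r

  Star⇒Iter : ∀ {x y} → Star _⟶_ x y → ∃ λ k → Iter _⟶_ k x y
  Star⇒Iter ε = 0 , done
  Star⇒Iter (s ◅ r) = _ , step s (proj₂ (Star⇒Iter r))

Iter-map : ∀ {A B : Set} {_⟶_ : A → A → Set} {_⟶′_ : B → B → Set} (f : A → B) →
  (∀ {x y} → x ⟶ y → f x ⟶′ f y) → ∀ {k x y} → Iter _⟶_ k x y → Iter _⟶′_ k (f x) (f y)
Iter-map f g done = done
Iter-map f g (step s r) = step (g s) (Iter-map f g r)

-- Step-indexed logical relations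

record World : Set₁ where
  infix 4 _⟶_ _⟶⟨_⟩_ _↠_
  infixl 8 _⊙_ _∙_
  field
    Carrier       : Set
    _⊙_           : Carrier → Carrier → Carrier
    nm            : ℕ → Carrier
    fixp          : Carrier → Carrier
    Typ           : Ty → Carrier → Set
    _⟶_           : Carrier → Carrier → Set
    deterministic : ∀ {x y z} → x ⟶ y → x ⟶ z → y ≡ z
    nm-normal     : ∀ {n x} → ¬ (nm n ⟶ x)
    nm-injective  : ∀ {m n} → nm m ≡ nm n → m ≡ n
    ⊙-stepˡ       : ∀ {x y z} → x ⟶ y → x ⊙ z ⟶ y ⊙ z
    -- The first step is kept apart: unfolding takes at least one step, and this step pays for
    -- lowering the index in `Rel-guard`.
    fixp-unfold   : ∀ f → ∃ λ z → (fixp f ⟶ z) × Star _⟶_ z (f ⊙ fixp f)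
    nm-Typ        : ∀ {n} → Typ int (nm n)
    ⊙-Typ         : ∀ {α β x a} → Typ (α ⇒ β) x → Typ α a → Typ β (x ⊙ a)
    fixp-Typ      : ∀ {α f} → Typ (α ⇒ α) f → Typ α (fixp f)

  _↠_ : Carrier → Carrier → Set
  _↠_ = Star _⟶_

  _⟶⟨_⟩_ : Carrier → ℕ → Carrier → Set
  x ⟶⟨ k ⟩ y = Iter _⟶_ k x y

  _∙_ : Carrier → List Carrier → Carrier
  x ∙ [] = x
  x ∙ (a ∷ T) = (x ⊙ a) ∙ T

  -- Complete argument lists: they bring a type down to `int`, where convergence can be observed.
  data Args : Ty → List Carrier → Set where
    []  : Args int []
    _∷_ : ∀ {α β a T} → Typ α a → Args β T → Args (α ⇒ β) (a ∷ T)

  ∙-step : ∀ {x y} T → x ⟶ y → x ∙ T ⟶ y ∙ T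
  ∙-step [] s = s
  ∙-step (a ∷ T) s = ∙-step T (⊙-stepˡ s)

  ∙-steps : ∀ {x y} T → x ↠ y → x ∙ T ↠ y ∙ T
  ∙-steps T = gmap (_∙ T) (∙-step T)

  ⊙-steps : ∀ {x y z} → x ↠ y → x ⊙ z ↠ y ⊙ z
  ⊙-steps = gmap _ ⊙-stepˡ

  -- By determinism the reduction to `y` is an initial piece of the run; it cannot overshoot, as
  -- numerals are normal.
  advance : ∀ {k n x y} → x ⟶⟨ k ⟩ nm n → x ↠ y → ∃ λ j → j ≤ k × y ⟶⟨ j ⟩ nm n
  advance r ε = _ , ≤-refl , r
  advance done (s ◅ _) = contradiction s nm-normal
  advance (step s r) (s′ ◅ r′) rewrite deterministic s s′ with advance r r′
  ... | j , j≤k , r″ = j , m≤n⇒m≤1+n j≤k , r″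

  value-unique : ∀ {k m n x} → x ⟶⟨ k ⟩ nm n → x ↠ nm m → m ≡ n
  value-unique r r′ = nm-injective (from-normal (proj₂ (proj₂ (advance r r′))))
    where
    from-normal : ∀ {k n x} → nm n ⟶⟨ k ⟩ x → nm n ≡ x
    from-normal done = refl
    from-normal (step s _) = contradiction s nm-normal

module LogicalRelation (X Y : World) where
  private
    module X = World X
    module Y = World Y

  -- Quantifying over all `j ≤ k` at arrow types makes the relation downward closed in the index,
  -- although the argument relation occurs negatively.
  Rel : ℕ → Ty → X.Carrier → Y.Carrier → Set
  Rel k int x y = ∀ {j n} → j < k → x X.⟶⟨ j ⟩ X.nm n → y Y.↠ Y.nm n
  Rel k (α ⇒ β) x y = ∀ {j a b} → j ≤ k → X.Typ α a → Y.Typ α b → Rel j α a b →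
    Rel j β (x X.⊙ a) (y Y.⊙ b)

  Rel-mono : ∀ α {j k x y} → j ≤ k → Rel k α x y → Rel j α x y
  Rel-mono int j≤k r i<j = r (<-≤-trans i<j j≤k)
  Rel-mono (α ⇒ β) j≤k r i≤j = r (≤-trans i≤j j≤k)

  Rel-zero : ∀ α {x y} → Rel 0 α x y
  Rel-zero int ()
  Rel-zero (α ⇒ β) z≤n _ _ _ = Rel-zero β

  Rel-value : ∀ {k n x y} → x X.↠ X.nm n → y Y.↠ Y.nm n → Rel k int x y
  Rel-value p q _ r with X.value-unique r p
  ... | refl = q

  -- It suffices to consider left runs on complete arguments, and such a run may be used to find the
  -- reducts `x′` and `y′`. This is how a test gets past its operand, whose value only the run
  -- reveals. Both reductions are asked for under complete arguments only, since a PCF test at arrow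
  -- type fires only there.
  Rel-step : ∀ α {k x y} →
    (∀ {T j n} → X.Args α T → j < k → (x X.∙ T) X.⟶⟨ j ⟩ X.nm n →
      ∃₂ λ x′ y′ → Rel k α x′ y′ × (x X.∙ T X.↠ x′ X.∙ T) ×
        (∀ {T′} → Y.Args α T′ → y Y.∙ T′ Y.↠ y′ Y.∙ T′)) →
    Rel k α x y
  Rel-step int h j<k r with h X.[] j<k r
  ... | x′ , y′ , rel , xs , ys with X.advance r xs
  ... | j′ , j′≤j , r′ = ys Y.[] ◅◅ rel (≤-<-trans j′≤j j<k) r′
  Rel-step (α ⇒ β) h j≤k ta tb rab = Rel-step β λ args i<j r →
    let x′ , y′ , rel , xs , ys = h (ta X.∷ args) (<-≤-trans i<j j≤k) r
    in _ , _ , rel j≤k ta tb rab , xs , λ args′ → ys (tb Y.∷ args′)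

  -- Reduction is free on both sides: on the left it only shortens what remains of a run, and on the
  -- right no steps are counted.
  Rel-expand : ∀ α {k x x′ y y′} → x X.↠ x′ → y Y.↠ y′ → Rel k α x′ y′ → Rel k α x y
  Rel-expand α p q rel = Rel-step α λ {T} _ _ _ →
    _ , _ , rel , X.∙-steps T p , λ {T′} _ → Y.∙-steps T′ q

  -- A left run to a numeral has to spend the step `s`, so what remains of it falls under the
  -- smaller index.
  Rel-guard : ∀ α {k x x₁ x′ y y′} → x X.⟶ x₁ → x₁ X.↠ x′ → y Y.↠ y′ →
    Rel k α x′ y′ → Rel (suc k) α x y
  Rel-guard int s p q rel _ done = contradiction s X.nm-normal
  Rel-guard int s p q rel (s≤s j<k) (step s′ r) rewrite X.deterministic s′ s with X.advance r p
  ... | j′ , j′≤j , r′ = q ◅◅ rel (≤-<-trans j′≤j j<k) r′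
  Rel-guard (α ⇒ β) s p q rel {zero} _ _ _ _ = Rel-zero β
  Rel-guard (α ⇒ β) s p q rel {suc j} (s≤s j≤k) ta tb rab =
    Rel-guard β (X.⊙-stepˡ s) (X.⊙-steps p) (Y.⊙-steps q)
      (rel j≤k ta tb (Rel-mono α (n≤1+n j) rab))

  Rel-fixp : ∀ k {α f g} → X.Typ (α ⇒ α) f → Y.Typ (α ⇒ α) g →
    Rel k (α ⇒ α) f g → Rel k α (X.fixp f) (Y.fixp g)
  Rel-fixp zero {α} _ _ _ = Rel-zero α
  Rel-fixp (suc k) {α} {f} {g} tf tg rel with X.fixp-unfold f | Y.fixp-unfold g
  ... | _ , s , p | _ , s′ , p′ = Rel-guard α s p (s′ ◅ p′)
    (rel (n≤1+n k) (X.fixp-Typ tf) (Y.fixp-Typ tg)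
      (Rel-fixp k tf tg (Rel-mono (α ⇒ α) {x = f} {y = g} (n≤1+n k) rel)))

-- Terms in an environment and their comparison in two worlds

lookup : ∀ {A : Set} → List (ℕ × A) → ℕ → Maybe A
lookup [] x = nothing
lookup ((y , a) ∷ γ) x = if x ≡ᵇ y then just a else lookup γ x

lookupT≡lookup : ∀ Γ x → lookupT Γ x ≡ lookup Γ x
lookupT≡lookup [] x = refl
lookupT≡lookup ((y , _) ∷ Γ) x with x ≡ᵇ y
... | true = refl
... | false = lookupT≡lookup Γ x

module _ (W : World) where
  open World W

  data CtxTyp : TCtx → List (ℕ × Carrier) → Set where
    []  : CtxTyp [] []
    _∷_ : ∀ {Γ γ x σ a} → Typ σ a → CtxTyp Γ γ → CtxTyp ((x , σ) ∷ Γ) ((x , a) ∷ γ)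

  -- PCF terms interpreted in W under an environment: closing substitution in PCF itself, and on
  -- the machine side Tr applied to a tape holding the environment.
  record TermModel : Set where
    field
      sem         : Term → List (ℕ × Carrier) → Carrier
      sem-Typ     : ∀ {Γ γ M α} → CtxTyp Γ γ → Γ ⊢ M ∶ α → Typ α (sem M γ)
      sem-var     : ∀ {Γ γ x a} → CtxTyp Γ γ → lookup γ x ≡ just a → sem (var x) γ ↠ a
      sem-lam     : ∀ {Γ γ x σ M τ a} → CtxTyp Γ γ → ((x , σ) ∷ Γ) ⊢ M ∶ τ → Typ σ a →
                    sem (lam x σ M) γ ⊙ a ↠ sem M ((x , a) ∷ γ)
      sem-app     : ∀ {Γ γ M N} → CtxTyp Γ γ → sem (M · N) γ ↠ sem M γ ⊙ sem N γ
      sem-num     : ∀ {Γ γ n} → CtxTyp Γ γ → sem (num n) γ ↠ nm n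
      sem-pred    : ∀ {Γ γ M m} → CtxTyp Γ γ → sem M γ ↠ nm m → sem (pred M) γ ↠ nm (m ∸ 1)
      sem-succ    : ∀ {Γ γ M m} → CtxTyp Γ γ → sem M γ ↠ nm m → sem (succ M) γ ↠ nm (suc m)
      sem-ifz0    : ∀ {Γ γ L M N} → CtxTyp Γ γ → sem L γ ↠ nm 0 → sem (ifz L M N) γ ↠ sem M γ
      sem-ifzS    : ∀ {Γ γ L M N m} → CtxTyp Γ γ → sem L γ ↠ nm (suc m) →
                    sem (ifz L M N) γ ↠ sem N γ
      sem-fix     : ∀ {Γ γ M} → CtxTyp Γ γ → sem (fix M) γ ↠ fixp (sem M γ)
      -- The bound `i ≤ j` keeps the operand's run below the index of the whole run, so the
      -- induction hypothesis applies to it.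
      pred-strict : ∀ {Γ γ M j n} → CtxTyp Γ γ → sem (pred M) γ ⟶⟨ j ⟩ nm n →
                    ∃₂ λ i m → i ≤ j × sem M γ ⟶⟨ i ⟩ nm m
      succ-strict : ∀ {Γ γ M j n} → CtxTyp Γ γ → sem (succ M) γ ⟶⟨ j ⟩ nm n →
                    ∃₂ λ i m → i ≤ j × sem M γ ⟶⟨ i ⟩ nm m
      ifz-strict  : ∀ {Γ γ L M N j n} → CtxTyp Γ γ → sem (ifz L M N) γ ⟶⟨ j ⟩ nm n →
                    ∃₂ λ i m → i ≤ j × sem L γ ⟶⟨ i ⟩ nm m

module _ {X Y : World} (𝓧 : TermModel X) (𝓨 : TermModel Y) where
  private
    module X where
      open World X public
      open TermModel 𝓧 public
    module Y where
      open World Y public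
      open TermModel 𝓨 public
  open LogicalRelation X Y

  data CtxRel (k : ℕ) : TCtx → List (ℕ × X.Carrier) → List (ℕ × Y.Carrier) → Set where
    []    : CtxRel k [] [] []
    entry : ∀ {Γ γ δ x σ a b} → X.Typ σ a → Y.Typ σ b → Rel k σ a b → CtxRel k Γ γ δ →
            CtxRel k ((x , σ) ∷ Γ) ((x , a) ∷ γ) ((x , b) ∷ δ)

  CtxRel-mono : ∀ {j k Γ γ δ} → j ≤ k → CtxRel k Γ γ δ → CtxRel j Γ γ δ
  CtxRel-mono j≤k [] = []
  CtxRel-mono j≤k (entry {σ = σ} ta tb r ρ) = entry ta tb (Rel-mono σ j≤k r) (CtxRel-mono j≤k ρ)

  CtxRel⇒Typˡ : ∀ {k Γ γ δ} → CtxRel k Γ γ δ → CtxTyp X Γ γ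
  CtxRel⇒Typˡ [] = []
  CtxRel⇒Typˡ (entry ta _ _ ρ) = ta ∷ CtxRel⇒Typˡ ρ

  CtxRel⇒Typʳ : ∀ {k Γ γ δ} → CtxRel k Γ γ δ → CtxTyp Y Γ δ
  CtxRel⇒Typʳ [] = []
  CtxRel⇒Typʳ (entry _ tb _ ρ) = tb ∷ CtxRel⇒Typʳ ρ

  CtxRel-lookup : ∀ {k Γ γ δ x σ} → CtxRel k Γ γ δ → lookupT Γ x ≡ just σ →
    ∃₂ λ a b → lookup γ x ≡ just a × lookup δ x ≡ just b × Rel k σ a b
  CtxRel-lookup {x = x} (entry {x = y} _ _ r ρ) eq with x ≡ᵇ y
  CtxRel-lookup (entry _ _ r ρ) refl | true = _ , _ , refl , refl , r
  ... | false = CtxRel-lookup ρ eq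

  sem-Rel : ∀ {k Γ γ δ M α} → CtxRel k Γ γ δ → Γ ⊢ M ∶ α → Rel k α (X.sem M γ) (Y.sem M δ)
  -- The typings of the two environments do not mention the index, so `go` carries them along
  -- unchanged while `ρ` is lowered.
  sem-Rel ρ = go ρ (CtxRel⇒Typˡ ρ) (CtxRel⇒Typʳ ρ)
    where
    go : ∀ {k Γ γ δ M α} → CtxRel k Γ γ δ → CtxTyp X Γ γ → CtxTyp Y Γ δ → Γ ⊢ M ∶ α →
      Rel k α (X.sem M γ) (Y.sem M δ)
    go {α = α} ρ l r (tvar eq) =
      let _ , _ , p , q , rel = CtxRel-lookup ρ eq
      in Rel-expand α (X.sem-var l p) (Y.sem-var r q) rel
    go ρ l r (tlam {τ = τ} t) j≤k ta tb rab =
      Rel-expand τ (X.sem-lam l t ta) (Y.sem-lam r t tb)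
        (go (entry ta tb rab (CtxRel-mono j≤k ρ)) (ta ∷ l) (tb ∷ r) t)
    go {α = α} ρ l r (tapp t u) = Rel-expand α (X.sem-app l) (Y.sem-app r)
      (go ρ l r t ≤-refl (X.sem-Typ l u) (Y.sem-Typ r u) (go ρ l r u))
    go ρ l r tnum = Rel-value (X.sem-num l) (Y.sem-num r)
    go ρ l r (tpred t) j<k s with X.pred-strict l s
    ... | _ , _ , i≤j , p = Rel-value (X.sem-pred l (Iter⇒Star p))
      (Y.sem-pred r (go ρ l r t (≤-<-trans i≤j j<k) p)) j<k s
    go ρ l r (tsucc t) j<k s with X.succ-strict l s
    ... | _ , _ , i≤j , p = Rel-value (X.sem-succ l (Iter⇒Star p))
      (Y.sem-succ r (go ρ l r t (≤-<-trans i≤j j<k) p)) j<k s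
    go ρ l r (tifz t u v) j<k s with X.ifz-strict l s
    ... | _ , zero , i≤j , p = Rel-expand int (X.sem-ifz0 l (Iter⇒Star p))
      (Y.sem-ifz0 r (go ρ l r t (≤-<-trans i≤j j<k) p)) (go ρ l r u) j<k s
    ... | _ , suc _ , i≤j , p = Rel-expand int (X.sem-ifzS l (Iter⇒Star p))
      (Y.sem-ifzS r (go ρ l r t (≤-<-trans i≤j j<k) p)) (go ρ l r v) j<k s
    go {α = α} ρ l r (tfix t) = Rel-expand α (X.sem-fix l) (Y.sem-fix r)
      (Rel-fixp _ (X.sem-Typ l t) (Y.sem-Typ r t) (go ρ l r t))

-- PCF

≡ᵇ-true : ∀ x y → (x ≡ᵇ y) ≡ true → x ≡ y
≡ᵇ-true x y e = ≡ᵇ⇒≡ x y (subst T (sym e) _)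

_∖_ : ∀ {A : Set} → (ℕ → Maybe A) → ℕ → ℕ → Maybe A
(s ∖ x) w = if w ≡ᵇ x then nothing else s w

_,_↦_ : ∀ {A : Set} → (ℕ → Maybe A) → ℕ → A → ℕ → Maybe A
(s , x ↦ a) w = if w ≡ᵇ x then just a else s w

-- Captures variables unless the substituted terms are closed.
_⟪_⟫ : Term → (ℕ → Maybe Term) → Term
var x ⟪ s ⟫ = fromMaybe (var x) (s x)
lam x σ M ⟪ s ⟫ = lam x σ (M ⟪ s ∖ x ⟫)
(M · N) ⟪ s ⟫ = (M ⟪ s ⟫) · (N ⟪ s ⟫)
num n ⟪ s ⟫ = num n
pred M ⟪ s ⟫ = pred (M ⟪ s ⟫)
succ M ⟪ s ⟫ = succ (M ⟪ s ⟫)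
ifz L M N ⟪ s ⟫ = ifz (L ⟪ s ⟫) (M ⟪ s ⟫) (N ⟪ s ⟫)
fix M ⟪ s ⟫ = fix (M ⟪ s ⟫)

weaken : ∀ {Γ Δ M α} → (∀ {x τ} → lookupT Γ x ≡ just τ → lookupT Δ x ≡ just τ) →
  Γ ⊢ M ∶ α → Δ ⊢ M ∶ α
weaken h (tvar eq) = tvar (h eq)
weaken {Γ} {Δ} h (tlam {x = x} {σ = σ} t) = tlam (weaken h′ t)
  where
  h′ : ∀ {w τ} → lookupT ((x , σ) ∷ Γ) w ≡ just τ → lookupT ((x , σ) ∷ Δ) w ≡ just τ
  h′ {w} eq with w ≡ᵇ x
  ... | true = eq
  ... | false = h eq
weaken h (tapp t u) = tapp (weaken h t) (weaken h u)
weaken h tnum = tnum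
weaken h (tpred t) = tpred (weaken h t)
weaken h (tsucc t) = tsucc (weaken h t)
weaken h (tifz t u v) = tifz (weaken h t) (weaken h u) (weaken h v)
weaken h (tfix t) = tfix (weaken h t)

weaken-closed : ∀ {Γ M α} → [] ⊢ M ∶ α → Γ ⊢ M ∶ α
weaken-closed = weaken λ ()

-- The typing context takes the place of the set of free variables, here and in the lemmas on
-- simultaneous substitution.
[/]-fresh : ∀ {Γ M α N x} → Γ ⊢ M ∶ α → lookupT Γ x ≡ nothing → M [ N / x ] ≡ M
[/]-fresh {x = x} (tvar {x = y} eq) f with y ≡ᵇ x in e
... | false = refl
... | true rewrite ≡ᵇ-true y x e with trans (sym eq) f
... | ()
[/]-fresh {Γ} {x = x} (tlam {x = y} {σ = σ} t) f with y ≡ᵇ x in e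
... | true = refl
... | false = cong (lam y σ) ([/]-fresh t f′)
  where
  f′ : lookupT ((y , σ) ∷ Γ) x ≡ nothing
  f′ with x ≡ᵇ y in e′
  ... | false = f
  ... | true with ≡ᵇ-true x y e′
  ... | refl with trans (sym e) e′
  ... | ()
[/]-fresh (tapp t u) f = cong₂ _·_ ([/]-fresh t f) ([/]-fresh u f)
[/]-fresh tnum f = refl
[/]-fresh (tpred t) f = cong pred ([/]-fresh t f)
[/]-fresh (tsucc t) f = cong succ ([/]-fresh t f)
[/]-fresh (tifz t u v) f with [/]-fresh t f | [/]-fresh u f | [/]-fresh v f
... | p | q | r = trans (cong (λ L → ifz L _ _) p) (cong₂ (ifz _) q r)
[/]-fresh (tfix t) f = cong fix ([/]-fresh t f)

[/]-closed : ∀ {M α N x} → [] ⊢ M ∶ α → M [ N / x ] ≡ M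
[/]-closed t = [/]-fresh t refl

cong-ifz : ∀ {L L′ M M′ N N′} → L ≡ L′ → M ≡ M′ → N ≡ N′ → ifz L M N ≡ ifz L′ M′ N′
cong-ifz refl refl refl = refl

⟪⟫-cong : ∀ {Γ M α s s′} → Γ ⊢ M ∶ α →
  (∀ {x τ} → lookupT Γ x ≡ just τ → s x ≡ s′ x) → M ⟪ s ⟫ ≡ M ⟪ s′ ⟫
⟪⟫-cong (tvar eq) h = cong (fromMaybe _) (h eq)
⟪⟫-cong {Γ} {s = s} {s′} (tlam {x = x} {σ = σ} t) h = cong (lam x σ) (⟪⟫-cong t h′)
  where
  h′ : ∀ {w τ} → lookupT ((x , σ) ∷ Γ) w ≡ just τ → (s ∖ x) w ≡ (s′ ∖ x) w
  h′ {w} eq with w ≡ᵇ x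
  ... | true = refl
  ... | false = h eq
⟪⟫-cong (tapp t u) h = cong₂ _·_ (⟪⟫-cong t h) (⟪⟫-cong u h)
⟪⟫-cong tnum h = refl
⟪⟫-cong (tpred t) h = cong pred (⟪⟫-cong t h)
⟪⟫-cong (tsucc t) h = cong succ (⟪⟫-cong t h)
⟪⟫-cong (tifz t u v) h = cong-ifz (⟪⟫-cong t h) (⟪⟫-cong u h) (⟪⟫-cong v h)
⟪⟫-cong (tfix t) h = cong fix (⟪⟫-cong t h)

⟪⟫-id : ∀ {M s} → (∀ x → s x ≡ nothing) → M ⟪ s ⟫ ≡ M
⟪⟫-id {var x} h = cong (fromMaybe _) (h x)
⟪⟫-id {lam x σ M} {s} h = cong (lam x σ) (⟪⟫-id h′)
  where
  h′ : ∀ w → (s ∖ x) w ≡ nothing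
  h′ w with w ≡ᵇ x
  ... | true = refl
  ... | false = h w
⟪⟫-id {M · N} h = cong₂ _·_ (⟪⟫-id h) (⟪⟫-id h)
⟪⟫-id {num n} h = refl
⟪⟫-id {pred M} h = cong pred (⟪⟫-id h)
⟪⟫-id {succ M} h = cong succ (⟪⟫-id h)
⟪⟫-id {ifz L M N} h = cong-ifz (⟪⟫-id h) (⟪⟫-id h) (⟪⟫-id h)
⟪⟫-id {fix M} h = cong fix (⟪⟫-id h)

⟪⟫-fresh : ∀ {Γ M α s} → Γ ⊢ M ∶ α → (∀ {x τ} → lookupT Γ x ≡ just τ → s x ≡ nothing) →
  M ⟪ s ⟫ ≡ M
⟪⟫-fresh t h = trans (⟪⟫-cong {s′ = λ _ → nothing} t h) (⟪⟫-id λ _ → refl)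

-- The second alternative arises under binders, where `s ∖ x` leaves the bound variable alone.
⟪⟫-⊢ : ∀ {Γ Δ M α s} → Γ ⊢ M ∶ α →
  (∀ {x τ} → lookupT Γ x ≡ just τ →
    (∃ λ a → s x ≡ just a × [] ⊢ a ∶ τ) ⊎ (s x ≡ nothing × lookupT Δ x ≡ just τ)) →
  Δ ⊢ M ⟪ s ⟫ ∶ α
⟪⟫-⊢ (tvar eq) h with h eq
... | inj₁ (a , p , t) rewrite p = weaken-closed t
... | inj₂ (p , q) rewrite p = tvar q
⟪⟫-⊢ {Γ} {Δ} {s = s} (tlam {x = x} {σ = σ} t) h = tlam (⟪⟫-⊢ t h′)
  where
  h′ : ∀ {w τ} → lookupT ((x , σ) ∷ Γ) w ≡ just τ →
    (∃ λ a → (s ∖ x) w ≡ just a × [] ⊢ a ∶ τ) ⊎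
    ((s ∖ x) w ≡ nothing × lookupT ((x , σ) ∷ Δ) w ≡ just τ)
  h′ {w} eq with w ≡ᵇ x
  ... | true = inj₂ (refl , eq)
  ... | false = h eq
⟪⟫-⊢ (tapp t u) h = tapp (⟪⟫-⊢ t h) (⟪⟫-⊢ u h)
⟪⟫-⊢ tnum h = tnum
⟪⟫-⊢ (tpred t) h = tpred (⟪⟫-⊢ t h)
⟪⟫-⊢ (tsucc t) h = tsucc (⟪⟫-⊢ t h)
⟪⟫-⊢ (tifz t u v) h = tifz (⟪⟫-⊢ t h) (⟪⟫-⊢ u h) (⟪⟫-⊢ v h)
⟪⟫-⊢ (tfix t) h = tfix (⟪⟫-⊢ t h)

-- This is why one beta step extends an environment: contraction substitutes `a` after the other
-- values are in place, and as these are closed it passes over them.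
⟪∖⟫-[/] : ∀ {Γ M α s x a} → Γ ⊢ M ∶ α → (∀ {w b} → s w ≡ just b → ∃ λ τ → [] ⊢ b ∶ τ) →
  (M ⟪ s ∖ x ⟫) [ a / x ] ≡ M ⟪ s , x ↦ a ⟫
⟪∖⟫-[/] {s = s} {x} {a} (tvar {x = w} _) c with w ≡ᵇ x in e
... | true rewrite e = refl
... | false with s w in e′
... | just b = [/]-closed (proj₂ (c e′))
... | nothing rewrite e = refl
⟪∖⟫-[/] {s = s} {x} {a} (tlam {x = z} {σ = σ} {M = M} t) c with z ≡ᵇ x in e
... | true rewrite ≡ᵇ-true z x e =
  cong (lam x σ) (⟪⟫-cong t λ {w} _ → shadow w)
  where
  shadow : ∀ w → ((s ∖ x) ∖ x) w ≡ ((s , x ↦ a) ∖ x) w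
  shadow w with w ≡ᵇ x
  ... | true = refl
  ... | false = refl
... | false = cong (lam z σ) (begin
  (M ⟪ (s ∖ x) ∖ z ⟫) [ a / x ]  ≡⟨ cong (_[ a / x ]) (⟪⟫-cong t λ {w} _ → ∖-comm w) ⟩
  (M ⟪ (s ∖ z) ∖ x ⟫) [ a / x ]  ≡⟨ ⟪∖⟫-[/] t (λ {w} → c′ w) ⟩
  M ⟪ (s ∖ z) , x ↦ a ⟫          ≡⟨ ⟪⟫-cong t (λ {w} _ → ↦-∖-comm w) ⟩
  M ⟪ (s , x ↦ a) ∖ z ⟫          ∎)
  where
  open ≡-Reasoning
  ∖-comm : ∀ w → ((s ∖ x) ∖ z) w ≡ ((s ∖ z) ∖ x) w
  ∖-comm w with w ≡ᵇ x | w ≡ᵇ z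
  ... | true | true = refl
  ... | true | false = refl
  ... | false | true = refl
  ... | false | false = refl
  c′ : ∀ w {b} → (s ∖ z) w ≡ just b → ∃ λ τ → [] ⊢ b ∶ τ
  c′ w eq with w ≡ᵇ z
  ... | false = c eq
  ↦-∖-comm : ∀ w → ((s ∖ z) , x ↦ a) w ≡ ((s , x ↦ a) ∖ z) w
  ↦-∖-comm w with w ≡ᵇ x in p | w ≡ᵇ z in q
  ... | true | false = refl
  ... | false | true = refl
  ... | false | false = refl
  ... | true | true with ≡ᵇ-true w z q
  ... | refl with trans (sym e) p
  ... | ()
⟪∖⟫-[/] (tapp t u) c = cong₂ _·_ (⟪∖⟫-[/] t c) (⟪∖⟫-[/] u c)
⟪∖⟫-[/] tnum c = refl
⟪∖⟫-[/] (tpred t) c = cong pred (⟪∖⟫-[/] t c)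
⟪∖⟫-[/] (tsucc t) c = cong succ (⟪∖⟫-[/] t c)
⟪∖⟫-[/] (tifz t u v) c = cong-ifz (⟪∖⟫-[/] t c) (⟪∖⟫-[/] u c) (⟪∖⟫-[/] v c)
⟪∖⟫-[/] (tfix t) c = cong fix (⟪∖⟫-[/] t c)

→PCF-deterministic : ∀ {M N N′} → M →PCF N → M →PCF N′ → N ≡ N′
→PCF-deterministic beta beta = refl
→PCF-deterministic fixβ fixβ = refl
→PCF-deterministic pred0 pred0 = refl
→PCF-deterministic predS predS = refl
→PCF-deterministic succN succN = refl
→PCF-deterministic ifz0 ifz0 = refl
→PCF-deterministic ifzS ifzS = refl
→PCF-deterministic (appL s) (appL s′) = cong (_· _) (→PCF-deterministic s s′)
→PCF-deterministic (predC s) (predC s′) = cong pred (→PCF-deterministic s s′)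
→PCF-deterministic (succC s) (succC s′) = cong succ (→PCF-deterministic s s′)
→PCF-deterministic (ifzC s) (ifzC s′) = cong (λ L → ifz L _ _) (→PCF-deterministic s s′)

num-injective : ∀ {m n} → num m ≡ num n → m ≡ n
num-injective refl = refl

pcf : World
pcf = record
  { Carrier = Term
  ; _⊙_ = _·_
  ; nm = num
  ; fixp = fix
  ; Typ = λ α M → [] ⊢ M ∶ α
  ; _⟶_ = _→PCF_
  ; deterministic = →PCF-deterministic
  ; nm-normal = λ ()
  ; nm-injective = num-injective
  ; ⊙-stepˡ = appL
  ; fixp-unfold = λ f → f · fix f , fixβ , ε
  ; nm-Typ = tnum
  ; ⊙-Typ = tapp
  ; fixp-Typ = tfix
  }

private
  module PCF = World pcf

beta-steps : ∀ {x σ M N K} → M [ N / x ] ≡ K → lam x σ M · N ↠PCF K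
beta-steps refl = beta ◅ ε

pred-num : ∀ m → pred (num m) →PCF num (m ∸ 1)
pred-num zero = pred0
pred-num (suc m) = predS

pred-steps : ∀ {M m} → M ↠PCF num m → pred M ↠PCF num (m ∸ 1)
pred-steps {m = m} r = gmap pred predC r ◅◅ pred-num m ◅ ε

succ-steps : ∀ {M m} → M ↠PCF num m → succ M ↠PCF num (suc m)
succ-steps r = gmap succ succC r ◅◅ succN ◅ ε

ifz-steps-0 : ∀ {L M N} → L ↠PCF num 0 → ifz L M N ↠PCF M
ifz-steps-0 r = gmap (λ L → ifz L _ _) ifzC r ◅◅ ifz0 ◅ ε

ifz-steps-suc : ∀ {L M N m} → L ↠PCF num (suc m) → ifz L M N ↠PCF N
ifz-steps-suc r = gmap (λ L → ifz L _ _) ifzC r ◅◅ ifzS ◅ ε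

PCF-pred-strict : ∀ {M j n} → pred M PCF.⟶⟨ j ⟩ num n → ∃₂ λ i m → i ≤ j × M PCF.⟶⟨ i ⟩ num m
PCF-pred-strict (step pred0 _) = _ , _ , z≤n , done
PCF-pred-strict (step predS _) = _ , _ , z≤n , done
PCF-pred-strict (step (predC s) r) with PCF-pred-strict r
... | _ , _ , i≤j , r′ = _ , _ , s≤s i≤j , step s r′

PCF-succ-strict : ∀ {M j n} → succ M PCF.⟶⟨ j ⟩ num n → ∃₂ λ i m → i ≤ j × M PCF.⟶⟨ i ⟩ num m
PCF-succ-strict (step succN _) = _ , _ , z≤n , done
PCF-succ-strict (step (succC s) r) with PCF-succ-strict r
... | _ , _ , i≤j , r′ = _ , _ , s≤s i≤j , step s r′

PCF-ifz-strict : ∀ {L M N j n} → ifz L M N PCF.⟶⟨ j ⟩ num n →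
  ∃₂ λ i m → i ≤ j × L PCF.⟶⟨ i ⟩ num m
PCF-ifz-strict (step ifz0 _) = _ , _ , z≤n , done
PCF-ifz-strict (step ifzS _) = _ , _ , z≤n , done
PCF-ifz-strict (step (ifzC s) r) with PCF-ifz-strict r
... | _ , _ , i≤j , r′ = _ , _ , s≤s i≤j , step s r′

CtxTyp-closed : ∀ {Γ γ x a} → CtxTyp pcf Γ γ → lookup γ x ≡ just a → ∃ λ τ → [] ⊢ a ∶ τ
CtxTyp-closed {x = x} (_∷_ {x = y} t ts) eq with x ≡ᵇ y
CtxTyp-closed (t ∷ ts) refl | true = _ , t
... | false = CtxTyp-closed ts eq

CtxTyp-lookup : ∀ {Γ γ x τ} → CtxTyp pcf Γ γ → lookupT Γ x ≡ just τ →
  ∃ λ a → lookup γ x ≡ just a × [] ⊢ a ∶ τ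
CtxTyp-lookup {x = x} (_∷_ {x = y} t ts) eq with x ≡ᵇ y
CtxTyp-lookup (t ∷ ts) refl | true = _ , refl , t
... | false = CtxTyp-lookup ts eq

pcfTerms : TermModel pcf
pcfTerms = record
  { sem = λ M γ → M ⟪ lookup γ ⟫
  ; sem-Typ = λ c t → ⟪⟫-⊢ t (inj₁ ∘ CtxTyp-lookup c)
  ; sem-var = λ {x = x} _ eq → subst (λ m → fromMaybe (var x) m ↠PCF _) (sym eq) ε
  ; sem-lam = λ c t _ → beta-steps (⟪∖⟫-[/] t (CtxTyp-closed c))
  ; sem-app = λ _ → ε
  ; sem-num = λ _ → ε
  ; sem-pred = λ _ → pred-steps
  ; sem-succ = λ _ → succ-steps
  ; sem-ifz0 = λ _ → ifz-steps-0
  ; sem-ifzS = λ _ → ifz-steps-suc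
  ; sem-fix = λ _ → ε
  ; pred-strict = λ _ → PCF-pred-strict
  ; succ-strict = λ _ → PCF-succ-strict
  ; ifz-strict = λ _ → PCF-ifz-strict
  }

-- Machine programs

module _ {A : Set} where
  slot-update : ∀ (R : List (Maybe A)) i {a b} → slot R i ≡ just a →
    slot (R [ i ≔ just b ]) i ≡ just b
  slot-update (_ ∷ R) zero eq = refl
  slot-update (_ ∷ R) (suc i) eq = slot-update R i eq

  slot-update-≢ : ∀ (R : List (Maybe A)) i j {a} → i ≢ j → slot (R [ i ≔ a ]) j ≡ slot R j
  slot-update-≢ [] i j ne = refl
  slot-update-≢ (_ ∷ R) zero zero ne = contradiction refl ne
  slot-update-≢ (_ ∷ R) zero (suc j) ne = refl
  slot-update-≢ (_ ∷ R) (suc i) zero ne = refl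
  slot-update-≢ (_ ∷ R) (suc i) (suc j) ne = slot-update-≢ R i j (ne ∘ cong suc)

  update-slot : ∀ (R : List (Maybe A)) i {a} → slot R i ≡ just a → R [ i ≔ just a ] ≡ R
  update-slot (_ ∷ R) zero refl = refl
  update-slot (_ ∷ R) (suc i) eq = cong (_ ∷_) (update-slot R i eq)

  update-update : ∀ (R : List (Maybe A)) i {a b} → (R [ i ≔ a ]) [ i ≔ b ] ≡ R [ i ≔ b ]
  update-update [] i = refl
  update-update (_ ∷ R) zero = refl
  update-update (_ ∷ R) (suc i) = cong (_ ∷_) (update-update R i)

module _ (W : World) where
  open World W

  data RegTyp : List (Maybe Ty) → List (Maybe Carrier) → Set where
    []    : RegTyp [] []
    empty : ∀ {Δ ρ} → RegTyp Δ ρ → RegTyp (nothing ∷ Δ) (nothing ∷ ρ)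
    entry : ∀ {Δ ρ τ a} → Typ τ a → RegTyp Δ ρ → RegTyp (just τ ∷ Δ) (just a ∷ ρ)

module _ {𝔸 : Set} {num𝔸 : ℕ → 𝔸} (tbl : AddressTable 𝔸 num𝔸) (W : World) where
  open World W

  -- Typed machine programs interpreted in W: as machines, or by a reverse translation into PCF.
  -- An operand that has been tested is evaluated in place: after register i has been found to
  -- hold the numeral m, its content a becomes operand a m, and the result of the test is one of
  -- predecessor a m, successor a m, branch a b c m (with b and c read after this evaluation, as
  -- their registers may be register i itself).
  record ProgModel : Set where
    field
      ⟦_⟧ᴾ : ∀ {Δ P σ} → _⊢ᴾ_∶_ tbl Δ P σ → List (Maybe Carrier) → Carrier
      ⟦_⟧ᴬ : ∀ {Δ A σ} → _⊢ᴬ_∶_ tbl Δ A σ → List (Maybe Carrier) → Carrier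
      ᴾ-Typ : ∀ {Δ P σ ρ} (d : _⊢ᴾ_∶_ tbl Δ P σ) → RegTyp W Δ ρ → Typ σ (⟦ d ⟧ᴾ ρ)
      load-step : ∀ {Δ i P τ σ ρ a} (d : _⊢ᴾ_∶_ tbl (Δ [ i ≔ just τ ]) P σ) →
        RegTyp W Δ ρ → Typ τ a →
        ⟦ tLoad {Δ = Δ} {i} {τ = τ} d ⟧ᴾ ρ ⊙ a ↠ ⟦ d ⟧ᴾ (ρ [ i ≔ just a ])
      act-step : ∀ {Δ A σ ρ} (d : _⊢ᴬ_∶_ tbl Δ A σ) → ⟦ tAct d ⟧ᴾ ρ ↠ ⟦ d ⟧ᴬ ρ
      call-step : ∀ {Δ i σ ρ a} (p : slot Δ i ≡ just σ) → slot ρ i ≡ just a →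
        ⟦ tCall {Δ = Δ} {i} p ⟧ᴬ ρ ↠ a
      app-step : ∀ {Δ i j k A τ υ σ ρ a b} (p : slot Δ i ≡ just (τ ⇒ υ)) (q : slot Δ j ≡ just τ)
        (d : _⊢ᴬ_∶_ tbl (Δ [ k ≔ just υ ]) A σ) → RegTyp W Δ ρ →
        slot ρ i ≡ just a → slot ρ j ≡ just b → Typ (τ ⇒ υ) a → Typ τ b →
        ⟦ tApp {Δ = Δ} {i} {j} {k} p q d ⟧ᴬ ρ ↠ ⟦ d ⟧ᴬ (ρ [ k ≔ just (a ⊙ b) ])

      operand predecessor successor : Carrier → ℕ → Carrier
      branch : Carrier → Carrier → Carrier → ℕ → Carrier
      operand-Typ : ∀ {a m} → Typ int a → Typ int (operand a m)
      predecessor-Typ : ∀ {a m} → Typ int a → Typ int (predecessor a m)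
      successor-Typ : ∀ {a m} → Typ int a → Typ int (successor a m)
      branch-Typ : ∀ {a b c m} → Typ int a → Typ int b → Typ int c → Typ int (branch a b c m)
      operand-value : ∀ {a m} → a ↠ nm m → operand a m ↠ nm m
      predecessor-value : ∀ {a m} → a ↠ nm m → predecessor a m ↠ nm (m ∸ 1)
      successor-value : ∀ {a m} → a ↠ nm m → successor a m ↠ nm (suc m)
      branch-zero : ∀ {a b c} → a ↠ nm 0 → branch a b c 0 ↠ b
      branch-suc : ∀ {a b c m} → a ↠ nm (suc m) → branch a b c (suc m) ↠ c

      pred-step : ∀ {Δ i j A σ ρ a m T} (p : slot Δ i ≡ just int)
        (d : _⊢ᴬ_∶_ tbl (Δ [ j ≔ just int ]) A σ) → RegTyp W Δ ρ → Args σ T →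
        slot ρ i ≡ just a → Typ int a → a ↠ nm m →
        ⟦ tPred {Δ = Δ} {i} {j} p d ⟧ᴬ ρ ∙ T ↠
        ⟦ d ⟧ᴬ ((ρ [ i ≔ just (operand a m) ]) [ j ≔ just (predecessor a m) ]) ∙ T
      pred-strict : ∀ {Δ i j A σ ρ a T k n} (p : slot Δ i ≡ just int)
        (d : _⊢ᴬ_∶_ tbl (Δ [ j ≔ just int ]) A σ) → RegTyp W Δ ρ → Args σ T →
        slot ρ i ≡ just a → Typ int a →
        ⟦ tPred {Δ = Δ} {i} {j} p d ⟧ᴬ ρ ∙ T ⟶⟨ k ⟩ nm n → ∃₂ λ l m → l ≤ k × a ⟶⟨ l ⟩ nm m
      succ-step : ∀ {Δ i j A σ ρ a m T} (p : slot Δ i ≡ just int)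
        (d : _⊢ᴬ_∶_ tbl (Δ [ j ≔ just int ]) A σ) → RegTyp W Δ ρ → Args σ T →
        slot ρ i ≡ just a → Typ int a → a ↠ nm m →
        ⟦ tSucc {Δ = Δ} {i} {j} p d ⟧ᴬ ρ ∙ T ↠
        ⟦ d ⟧ᴬ ((ρ [ i ≔ just (operand a m) ]) [ j ≔ just (successor a m) ]) ∙ T
      succ-strict : ∀ {Δ i j A σ ρ a T k n} (p : slot Δ i ≡ just int)
        (d : _⊢ᴬ_∶_ tbl (Δ [ j ≔ just int ]) A σ) → RegTyp W Δ ρ → Args σ T →
        slot ρ i ≡ just a → Typ int a →
        ⟦ tSucc {Δ = Δ} {i} {j} p d ⟧ᴬ ρ ∙ T ⟶⟨ k ⟩ nm n → ∃₂ λ l m → l ≤ k × a ⟶⟨ l ⟩ nm m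
      ifz-step : ∀ {Δ i j k l A σ ρ a b c m T} (p : slot Δ i ≡ just int)
        (q : slot Δ j ≡ just int) (r : slot Δ k ≡ just int)
        (d : _⊢ᴬ_∶_ tbl (Δ [ l ≔ just int ]) A σ) → RegTyp W Δ ρ → Args σ T →
        slot ρ i ≡ just a → slot (ρ [ i ≔ just (operand a m) ]) j ≡ just b →
        slot (ρ [ i ≔ just (operand a m) ]) k ≡ just c → Typ int a → a ↠ nm m →
        ⟦ tIfz {Δ = Δ} {i} {j} {k} {l} p q r d ⟧ᴬ ρ ∙ T ↠
        ⟦ d ⟧ᴬ ((ρ [ i ≔ just (operand a m) ]) [ l ≔ just (branch a b c m) ]) ∙ T
      ifz-strict : ∀ {Δ i j k l A σ ρ a T s n} (p : slot Δ i ≡ just int)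
        (q : slot Δ j ≡ just int) (r : slot Δ k ≡ just int)
        (d : _⊢ᴬ_∶_ tbl (Δ [ l ≔ just int ]) A σ) → RegTyp W Δ ρ → Args σ T →
        slot ρ i ≡ just a → Typ int a →
        ⟦ tIfz {Δ = Δ} {i} {j} {k} {l} p q r d ⟧ᴬ ρ ∙ T ⟶⟨ s ⟩ nm n →
        ∃₂ λ t m → t ≤ s × a ⟶⟨ t ⟩ nm m

      fixpoint : Ty → Carrier
      fixpoint-Typ : ∀ {α} → Typ ((α ⇒ α) ⇒ α) (fixpoint α)
      fixpoint-step : ∀ {α f} → Typ (α ⇒ α) f → fixpoint α ⊙ f ↠ fixp f

    mutual
      -- The recursion is on the typing derivation: registers and tapes hold addresses of further
      -- machines, and only the derivation gives a well-founded way to follow them.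
      ⟦_⟧ᴹ : ∀ {M α} → _∶ᴹ_ tbl M α → Carrier
      ⟦ tNum {n} ⟧ᴹ = nm n
      ⟦ tMach rs d ts ⟧ᴹ = ⟦ d ⟧ᴾ ⟦ rs ⟧ᴿ ∙ ⟦ ts ⟧ᵀ
      ⟦ tY {α = α} _ ts ⟧ᴹ = fixpoint α ∙ ⟦ ts ⟧ᵀ

      ⟦_⟧ᴿ : ∀ {Δ R} → RegsTy tbl Δ R → List (Maybe Carrier)
      ⟦ [] ⟧ᴿ = []
      ⟦ ∅∷ rs ⟧ᴿ = nothing ∷ ⟦ rs ⟧ᴿ
      ⟦ D ∷ᵗ rs ⟧ᴿ = just ⟦ D ⟧ᴹ ∷ ⟦ rs ⟧ᴿ

      ⟦_⟧ᵀ : ∀ {T τs} → TapeTy tbl T τs → List Carrier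
      ⟦ [] ⟧ᵀ = []
      ⟦ D ∷ ts ⟧ᵀ = ⟦ D ⟧ᴹ ∷ ⟦ ts ⟧ᵀ

    mutual
      ᴹ-Typ : ∀ {M α} (D : _∶ᴹ_ tbl M α) → Typ α ⟦ D ⟧ᴹ
      ᴹ-Typ tNum = nm-Typ
      ᴹ-Typ (tMach rs d ts) = ᵀ-Typ ts (ᴾ-Typ d (ᴿ-Typ rs))
      ᴹ-Typ (tY eq ts) = ᵀ-Typ ts (subst (λ τ → Typ τ _) eq fixpoint-Typ)

      ᴿ-Typ : ∀ {Δ R} (rs : RegsTy tbl Δ R) → RegTyp W Δ ⟦ rs ⟧ᴿ
      ᴿ-Typ [] = []
      ᴿ-Typ (∅∷ rs) = empty (ᴿ-Typ rs)
      ᴿ-Typ (D ∷ᵗ rs) = entry (ᴹ-Typ D) (ᴿ-Typ rs)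

      ᵀ-Typ : ∀ {T τs α x} (ts : TapeTy tbl T τs) → Typ (τs ⇛ α) x → Typ α (x ∙ ⟦ ts ⟧ᵀ)
      ᵀ-Typ [] t = t
      ᵀ-Typ (D ∷ ts) t = ᵀ-Typ ts (⊙-Typ t (ᴹ-Typ D))

-- Comparison of two readings of typed machines

module _ {𝔸 : Set} {num𝔸 : ℕ → 𝔸} {tbl : AddressTable 𝔸 num𝔸} {X Y : World}
  (𝓧 : ProgModel tbl X) (𝓨 : ProgModel tbl Y) where
  private
    module X where
      open World X public
      open ProgModel 𝓧 public
    module Y where
      open World Y public
      open ProgModel 𝓨 public
  open LogicalRelation X Y

  data RegRel (k : ℕ) :
    List (Maybe Ty) → List (Maybe X.Carrier) → List (Maybe Y.Carrier) → Set where
    []    : RegRel k [] [] []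
    empty : ∀ {Δ ρ π} → RegRel k Δ ρ π → RegRel k (nothing ∷ Δ) (nothing ∷ ρ) (nothing ∷ π)
    entry : ∀ {Δ ρ π τ a b} → X.Typ τ a → Y.Typ τ b → Rel k τ a b → RegRel k Δ ρ π →
            RegRel k (just τ ∷ Δ) (just a ∷ ρ) (just b ∷ π)

  RegRel-mono : ∀ {j k Δ ρ π} → j ≤ k → RegRel k Δ ρ π → RegRel j Δ ρ π
  RegRel-mono j≤k [] = []
  RegRel-mono j≤k (empty ρ) = empty (RegRel-mono j≤k ρ)
  RegRel-mono j≤k (entry {τ = τ} ta tb r ρ) = entry ta tb (Rel-mono τ j≤k r) (RegRel-mono j≤k ρ)

  RegRel⇒Typˡ : ∀ {k Δ ρ π} → RegRel k Δ ρ π → RegTyp X Δ ρ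
  RegRel⇒Typˡ [] = []
  RegRel⇒Typˡ (empty ρ) = empty (RegRel⇒Typˡ ρ)
  RegRel⇒Typˡ (entry ta _ _ ρ) = entry ta (RegRel⇒Typˡ ρ)

  RegRel⇒Typʳ : ∀ {k Δ ρ π} → RegRel k Δ ρ π → RegTyp Y Δ π
  RegRel⇒Typʳ [] = []
  RegRel⇒Typʳ (empty ρ) = empty (RegRel⇒Typʳ ρ)
  RegRel⇒Typʳ (entry _ tb _ ρ) = entry tb (RegRel⇒Typʳ ρ)

  RegRel-slot : ∀ {k Δ ρ π τ} i → RegRel k Δ ρ π → slot Δ i ≡ just τ →
    ∃₂ λ a b → slot ρ i ≡ just a × slot π i ≡ just b × X.Typ τ a × Y.Typ τ b × Rel k τ a b
  RegRel-slot zero (entry ta tb r _) refl = _ , _ , refl , refl , ta , tb , r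
  RegRel-slot (suc i) (empty ρ) eq = RegRel-slot i ρ eq
  RegRel-slot (suc i) (entry _ _ _ ρ) eq = RegRel-slot i ρ eq

  RegRel-update : ∀ {k Δ ρ π τ a b} i → X.Typ τ a → Y.Typ τ b → Rel k τ a b → RegRel k Δ ρ π →
    RegRel k (Δ [ i ≔ just τ ]) (ρ [ i ≔ just a ]) (π [ i ≔ just b ])
  RegRel-update i ta tb r [] = []
  RegRel-update zero ta tb r (empty ρ) = entry ta tb r ρ
  RegRel-update zero ta tb r (entry _ _ _ ρ) = entry ta tb r ρ
  RegRel-update {τ = τ} (suc i) ta tb r (empty ρ) = empty (RegRel-update {τ = τ} i ta tb r ρ)
  RegRel-update {τ = τ} (suc i) ta tb r (entry ta′ tb′ r′ ρ) =
    entry ta′ tb′ r′ (RegRel-update {τ = τ} i ta tb r ρ)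

  RegRel-operand : ∀ {k Δ ρ π a b m} i → slot Δ i ≡ just int → X.Typ int a → Y.Typ int b →
    a X.↠ X.nm m → b Y.↠ Y.nm m → RegRel k Δ ρ π →
    RegRel k Δ (ρ [ i ≔ just (X.operand a m) ]) (π [ i ≔ just (Y.operand b m) ])
  RegRel-operand {Δ = Δ} i p ta tb xs ys ρ =
    -- Register `i` has type `int` before and after the evaluation, so the updated context is `Δ`
    -- again.
    subst (λ Δ → RegRel _ Δ _ _) (update-slot Δ i p)
      (RegRel-update i (X.operand-Typ ta) (Y.operand-Typ tb)
        (Rel-value (X.operand-value xs) (Y.operand-value ys)) ρ)

  -- For the tests, strictness extracts from a left run a run of the tested register that is no
  -- longer. The relation between the two registers turns it into convergence on the right to the
  -- same numeral, and then both sides get past the test.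
  ᴬ-Rel : ∀ {k Δ A σ ρ π} (d : _⊢ᴬ_∶_ tbl Δ A σ) → RegRel k Δ ρ π →
    Rel k σ (X.⟦ d ⟧ᴬ ρ) (Y.⟦ d ⟧ᴬ π)
  ᴬ-Rel (tCall {i = i} {σ} p) ρ with RegRel-slot i ρ p
  ... | _ , _ , u , v , _ , _ , r = Rel-expand σ (X.call-step p u) (Y.call-step p v) r
  ᴬ-Rel (tApp {i = i} {j} {k} {τ = τ} {υ} {σ} p q d) ρ
    with RegRel-slot i ρ p | RegRel-slot j ρ q
  ... | _ , _ , u , v , ta , tb , r | _ , _ , u′ , v′ , ta′ , tb′ , r′ =
    Rel-expand σ
      (X.app-step p q d (RegRel⇒Typˡ ρ) u u′ ta ta′) (Y.app-step p q d (RegRel⇒Typʳ ρ) v v′ tb tb′)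
      (ᴬ-Rel d (RegRel-update k (X.⊙-Typ ta ta′) (Y.⊙-Typ tb tb′) (r ≤-refl ta′ tb′ r′) ρ))
  ᴬ-Rel (tPred {i = i} {j} {σ = σ} p d) ρ with RegRel-slot i ρ p
  ... | _ , _ , u , v , ta , tb , r = Rel-step σ λ args j<k s →
    let _ , _ , l≤k , s′ = X.pred-strict p d (RegRel⇒Typˡ ρ) args u ta s
        xs = Iter⇒Star s′
        ys = r (≤-<-trans l≤k j<k) s′
    in _ , _ ,
       ᴬ-Rel d (RegRel-update j (X.predecessor-Typ ta) (Y.predecessor-Typ tb)
         (Rel-value (X.predecessor-value xs) (Y.predecessor-value ys))
         (RegRel-operand i p ta tb xs ys ρ)) ,
       X.pred-step p d (RegRel⇒Typˡ ρ) args u ta xs ,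
       λ args′ → Y.pred-step p d (RegRel⇒Typʳ ρ) args′ v tb ys
  ᴬ-Rel (tSucc {i = i} {j} {σ = σ} p d) ρ with RegRel-slot i ρ p
  ... | _ , _ , u , v , ta , tb , r = Rel-step σ λ args j<k s →
    let _ , _ , l≤k , s′ = X.succ-strict p d (RegRel⇒Typˡ ρ) args u ta s
        xs = Iter⇒Star s′
        ys = r (≤-<-trans l≤k j<k) s′
    in _ , _ ,
       ᴬ-Rel d (RegRel-update j (X.successor-Typ ta) (Y.successor-Typ tb)
         (Rel-value (X.successor-value xs) (Y.successor-value ys))
         (RegRel-operand i p ta tb xs ys ρ)) ,
       X.succ-step p d (RegRel⇒Typˡ ρ) args u ta xs ,
       λ args′ → Y.succ-step p d (RegRel⇒Typʳ ρ) args′ v tb ys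
  ᴬ-Rel {k = k₀} (tIfz {i = i} {j} {k} {l} {σ = σ} p q r d) ρ with RegRel-slot i ρ p
  ... | a , b , u , v , ta , tb , rel = Rel-step σ λ args j<k s →
    let _ , m , l≤k , s′ = X.ifz-strict p q r d (RegRel⇒Typˡ ρ) args u ta s
        xs = Iter⇒Star s′
        ys = rel (≤-<-trans l≤k j<k) s′
        ρ′ = RegRel-operand i p ta tb xs ys ρ
        a₀ , b₀ , u₀ , v₀ , ta₀ , tb₀ , rel₀ = RegRel-slot j ρ′ q
        a₁ , b₁ , u₁ , v₁ , ta₁ , tb₁ , rel₁ = RegRel-slot k ρ′ r
    in _ , _ ,
       ᴬ-Rel d (RegRel-update l (X.branch-Typ ta ta₀ ta₁) (Y.branch-Typ tb tb₀ tb₁)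
         (branch-Rel m xs ys rel₀ rel₁) ρ′) ,
       X.ifz-step p q r d (RegRel⇒Typˡ ρ) args u u₀ u₁ ta xs ,
       λ args′ → Y.ifz-step p q r d (RegRel⇒Typʳ ρ) args′ v v₀ v₁ tb ys
    where
    branch-Rel : ∀ m {a₀ b₀ a₁ b₁} → a X.↠ X.nm m → b Y.↠ Y.nm m →
      Rel k₀ int a₀ b₀ → Rel k₀ int a₁ b₁ → Rel k₀ int (X.branch a a₀ a₁ m) (Y.branch b b₀ b₁ m)
    branch-Rel zero xs ys rel₀ rel₁ = Rel-expand int (X.branch-zero xs) (Y.branch-zero ys) rel₀
    branch-Rel (suc m) xs ys rel₀ rel₁ = Rel-expand int (X.branch-suc xs) (Y.branch-suc ys) rel₁

  ᴾ-Rel : ∀ {k Δ P σ ρ π} (d : _⊢ᴾ_∶_ tbl Δ P σ) → RegRel k Δ ρ π →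
    Rel k σ (X.⟦ d ⟧ᴾ ρ) (Y.⟦ d ⟧ᴾ π)
  ᴾ-Rel (tLoad {i = i} {σ = σ} d) ρ j≤k ta tb r =
    Rel-expand σ (X.load-step d (RegRel⇒Typˡ ρ) ta) (Y.load-step d (RegRel⇒Typʳ ρ) tb)
      (ᴾ-Rel d (RegRel-update i ta tb r (RegRel-mono j≤k ρ)))
  ᴾ-Rel (tAct {σ = σ} d) ρ = Rel-expand σ (X.act-step d) (Y.act-step d) (ᴬ-Rel d ρ)

  mutual
    ᴹ-Rel : ∀ {k M α} (D : _∶ᴹ_ tbl M α) → Rel k α X.⟦ D ⟧ᴹ Y.⟦ D ⟧ᴹ
    ᴹ-Rel tNum = Rel-value ε ε
    ᴹ-Rel (tMach {α = α} rs d ts) = ᵀ-Rel ts (ᴾ-Rel d (ᴿ-Rel rs))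
    ᴹ-Rel {k} (tY {α = α} eq ts) = ᵀ-Rel ts
      (subst (λ τ → Rel k τ (X.fixpoint α) (Y.fixpoint α)) eq λ {j} _ ta tb r →
        Rel-expand α (X.fixpoint-step ta) (Y.fixpoint-step tb) (Rel-fixp j ta tb r))

    ᴿ-Rel : ∀ {k Δ R} (rs : RegsTy tbl Δ R) → RegRel k Δ X.⟦ rs ⟧ᴿ Y.⟦ rs ⟧ᴿ
    ᴿ-Rel [] = []
    ᴿ-Rel (∅∷ rs) = empty (ᴿ-Rel rs)
    ᴿ-Rel (D ∷ᵗ rs) = entry (X.ᴹ-Typ D) (Y.ᴹ-Typ D) (ᴹ-Rel D) (ᴿ-Rel rs)

    ᵀ-Rel : ∀ {k T τs α x y} (ts : TapeTy tbl T τs) → Rel k (τs ⇛ α) x y →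
      Rel k α (x X.∙ X.⟦ ts ⟧ᵀ) (y Y.∙ Y.⟦ ts ⟧ᵀ)
    ᵀ-Rel [] r = r
    ᵀ-Rel (D ∷ ts) r = ᵀ-Rel ts (r ≤-refl (X.ᴹ-Typ D) (Y.ᴹ-Typ D) (ᴹ-Rel D))

-- Reverse translation

≡⇒↠PCF : ∀ {M N} → M ≡ N → M ↠PCF N
≡⇒↠PCF refl = ε

-- test σ X Z evaluates X, of type int, before it continues as Z, of type σ: ifz is only
-- available at type int, so at higher types the test waits for all the arguments of Z.
force : Ty → Term
force int = lam 0 int (lam 1 int (ifz (var 0) (var 1) (var 1)))
force (α ⇒ β) =
  lam 0 int (lam 1 (α ⇒ β) (lam 2 α ((force β · var 0) · (var 1 · var 2))))

test : Ty → Term → Term → Term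
test σ X Z = (force σ · X) · Z

force-⊢ : ∀ {Γ} σ → Γ ⊢ force σ ∶ int ⇒ σ ⇒ σ
force-⊢ int = tlam (tlam (tifz (tvar refl) (tvar refl) (tvar refl)))
force-⊢ (α ⇒ β) =
  tlam (tlam (tlam (tapp (tapp (force-⊢ β) (tvar refl)) (tapp (tvar refl) (tvar refl)))))

test-int : ∀ {X Z} → [] ⊢ X ∶ int → test int X Z ↠PCF ifz X Z Z
test-int tx = appL beta ◅ beta ◅ ≡⇒↠PCF (cong-ifz ([/]-closed tx) refl refl)

-- `X`, `Z` and `force β` are closed, so the names 0, 1 and 2, reused at every level of `force`,
-- interfere with nothing.
test-⇒ : ∀ {α β X Z a} → [] ⊢ X ∶ int → [] ⊢ Z ∶ α ⇒ β →
  test (α ⇒ β) X Z · a ↠PCF test β X (Z · a)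
test-⇒ {β = β} {X} {Z} {a} tx tz = appL (appL beta) ◅ appL beta ◅ beta ◅
  ≡⇒↠PCF (cong₂ _·_ (cong₂ _·_ forceβ x) (cong (_· a) ([/]-closed tz)))
  where
  forceβ : ((force β [ X / 0 ]) [ Z / 1 ]) [ a / 2 ] ≡ force β
  forceβ rewrite [/]-closed {N = X} {x = 0} (force-⊢ β) | [/]-closed {N = Z} {x = 1} (force-⊢ β) =
    [/]-closed (force-⊢ β)
  x : (X [ Z / 1 ]) [ a / 2 ] ≡ X
  x rewrite [/]-closed {N = Z} {x = 1} tx = [/]-closed tx

test-steps : ∀ {σ X Z T m} → [] ⊢ X ∶ int → [] ⊢ Z ∶ σ → PCF.Args σ T → X ↠PCF num m →
  test σ X Z PCF.∙ T ↠PCF Z PCF.∙ T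
test-steps {m = zero} tx tz PCF.[] r = test-int tx ◅◅ ifz-steps-0 r
test-steps {m = suc m} tx tz PCF.[] r = test-int tx ◅◅ ifz-steps-suc r
test-steps {T = _ ∷ T} tx tz (ta PCF.∷ args) r =
  PCF.∙-steps T (test-⇒ tx tz) ◅◅ test-steps tx (tapp tz ta) args r

test-strict : ∀ {σ X Z T j n} → [] ⊢ X ∶ int → [] ⊢ Z ∶ σ → PCF.Args σ T →
  test σ X Z PCF.∙ T PCF.⟶⟨ j ⟩ num n → ∃₂ λ i m → i ≤ j × X PCF.⟶⟨ i ⟩ num m
test-strict tx tz PCF.[] r with PCF.advance r (test-int tx)
... | _ , j′≤j , r′ with PCF-ifz-strict r′
... | i , m , i≤j′ , s = i , m , ≤-trans i≤j′ j′≤j , s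
test-strict {T = _ ∷ T} tx tz (ta PCF.∷ args) r
  with PCF.advance r (PCF.∙-steps T (test-⇒ tx tz))
... | _ , j′≤j , r′ with test-strict tx (tapp tz ta) args r′
... | i , m , i≤j′ , s = i , m , ≤-trans i≤j′ j′≤j , s

shift : TCtx → TCtx
shift [] = []
shift ((x , τ) ∷ Γ) = (suc x , τ) ∷ shift Γ

-- The variable i stands for register i.
toCtx : List (Maybe Ty) → TCtx
toCtx [] = []
toCtx (nothing ∷ Δ) = shift (toCtx Δ)
toCtx (just τ ∷ Δ) = (0 , τ) ∷ shift (toCtx Δ)

lookup-shift-zero : ∀ Γ → lookupT (shift Γ) 0 ≡ nothing
lookup-shift-zero [] = refl
lookup-shift-zero (_ ∷ Γ) = lookup-shift-zero Γ

lookup-shift-suc : ∀ Γ x → lookupT (shift Γ) (suc x) ≡ lookupT Γ x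
lookup-shift-suc [] x = refl
lookup-shift-suc ((y , _) ∷ Γ) x with x ≡ᵇ y
... | true = refl
... | false = lookup-shift-suc Γ x

lookup-toCtx : ∀ Δ x → lookupT (toCtx Δ) x ≡ slot Δ x
lookup-toCtx [] x = refl
lookup-toCtx (nothing ∷ Δ) zero = lookup-shift-zero (toCtx Δ)
lookup-toCtx (nothing ∷ Δ) (suc x) = trans (lookup-shift-suc (toCtx Δ) x) (lookup-toCtx Δ x)
lookup-toCtx (just τ ∷ Δ) zero = refl
lookup-toCtx (just τ ∷ Δ) (suc x) = trans (lookup-shift-suc (toCtx Δ) x) (lookup-toCtx Δ x)

-- Only an implication: an update beyond the last register does nothing, whereas `k ↦ υ` always
-- binds `k`.
slot-update-just : ∀ {A : Set} (Δ : List (Maybe A)) k x {υ τ} →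
  slot (Δ [ k ≔ just υ ]) x ≡ just τ → (slot Δ , k ↦ υ) x ≡ just τ
slot-update-just (_ ∷ Δ) zero zero eq = eq
slot-update-just (_ ∷ Δ) zero (suc x) eq = eq
slot-update-just (_ ∷ Δ) (suc k) zero eq = eq
slot-update-just (_ ∷ Δ) (suc k) (suc x) eq = slot-update-just Δ k x eq

toCtx-update : ∀ {Δ k υ x τ} → lookupT (toCtx (Δ [ k ≔ just υ ])) x ≡ just τ →
  lookupT ((k , υ) ∷ toCtx Δ) x ≡ just τ
toCtx-update {Δ} {k} {υ} {x} eq rewrite lookup-toCtx Δ x =
  slot-update-just Δ k x (trans (sym (lookup-toCtx (Δ [ k ≔ just υ ]) x)) eq)

toCtx-var : ∀ {Δ i τ} → slot Δ i ≡ just τ → toCtx Δ ⊢ var i ∶ τ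
toCtx-var {Δ} {i} p = tvar (trans (lookup-toCtx Δ i) p)

RegTyp-slot : ∀ {Δ ρ τ} x → RegTyp pcf Δ ρ → slot Δ x ≡ just τ →
  ∃ λ a → slot ρ x ≡ just a × [] ⊢ a ∶ τ
RegTyp-slot zero (entry t _) refl = _ , refl , t
RegTyp-slot (suc x) (empty ts) eq = RegTyp-slot x ts eq
RegTyp-slot (suc x) (entry _ ts) eq = RegTyp-slot x ts eq

RegTyp-closed : ∀ {Δ ρ a} x → RegTyp pcf Δ ρ → slot ρ x ≡ just a → ∃ λ τ → [] ⊢ a ∶ τ
RegTyp-closed zero (entry t _) refl = _ , t
RegTyp-closed (suc x) (empty ts) eq = RegTyp-closed x ts eq
RegTyp-closed (suc x) (entry _ ts) eq = RegTyp-closed x ts eq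

-- The typed slot rules out reading an updated register beyond the last one, the case in which the
-- two sides differ.
RegTyp-update : ∀ {Δ ρ υ τ b} k x → RegTyp pcf Δ ρ → slot (Δ [ k ≔ just υ ]) x ≡ just τ →
  (slot ρ , k ↦ b) x ≡ slot (ρ [ k ≔ just b ]) x
RegTyp-update zero zero (empty ts) eq = refl
RegTyp-update zero zero (entry _ ts) eq = refl
RegTyp-update zero (suc x) (empty ts) eq = refl
RegTyp-update zero (suc x) (entry _ ts) eq = refl
RegTyp-update (suc k) zero (empty ts) eq = refl
RegTyp-update (suc k) zero (entry _ ts) eq = refl
RegTyp-update (suc k) (suc x) (empty ts) eq = RegTyp-update k x ts eq
RegTyp-update (suc k) (suc x) (entry _ ts) eq = RegTyp-update k x ts eq

toCtx-⟪⟫-⊢ : ∀ {Δ ρ M σ} → toCtx Δ ⊢ M ∶ σ → RegTyp pcf Δ ρ → [] ⊢ M ⟪ slot ρ ⟫ ∶ σ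
toCtx-⟪⟫-⊢ {Δ} t ts = ⟪⟫-⊢ t λ {x} eq → inj₁ (RegTyp-slot x ts (trans (sym (lookup-toCtx Δ x)) eq))

toCtx-lam : ∀ {Δ k υ M σ} → toCtx (Δ [ k ≔ just υ ]) ⊢ M ∶ σ → toCtx Δ ⊢ lam k υ M ∶ υ ⇒ σ
toCtx-lam {Δ} t = tlam (weaken (toCtx-update {Δ}) t)

assign-steps : ∀ {Δ ρ k υ M σ b} → toCtx (Δ [ k ≔ just υ ]) ⊢ M ∶ σ → RegTyp pcf Δ ρ →
  (lam k υ M ⟪ slot ρ ⟫) · b ↠PCF M ⟪ slot (ρ [ k ≔ just b ]) ⟫
assign-steps {Δ} {k = k} {υ} t ts = beta-steps (trans (⟪∖⟫-[/] t λ {w} → RegTyp-closed w ts)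
  (⟪⟫-cong t λ {x} eq →
    RegTyp-update k x ts (trans (sym (lookup-toCtx (Δ [ k ≔ just υ ]) x)) eq)))

var-slot : ∀ {ρ a} i → slot ρ i ≡ just a → var i ⟪ slot ρ ⟫ ≡ a
var-slot i eq = cong (fromMaybe (var i)) eq

-- Assignment to register `j` is a beta-redex whose binder shadows the old variable `j`. In its uses
-- `V` mentions `var i` again: PCF cannot store the value that the test has found, but evaluating
-- the operand once more yields the same numeral.
testAssign : Ty → ℕ → ℕ → Term → Term → Term
testAssign σ i j V M = test σ (var i) (lam j int M · V)

module _ {Δ i j V M σ} (p : slot Δ i ≡ just int) (tV : toCtx Δ ⊢ V ∶ int)
  (t : toCtx (Δ [ j ≔ just int ]) ⊢ M ∶ σ) where

  testAssign-⊢ : toCtx Δ ⊢ testAssign σ i j V M ∶ σ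
  testAssign-⊢ = tapp (tapp (force-⊢ σ) (toCtx-var {Δ} p)) (tapp (toCtx-lam {Δ} t) tV)

  module _ {ρ a v T} (ts : RegTyp pcf Δ ρ) (args : PCF.Args σ T) (u : slot ρ i ≡ just a)
    (ta : [] ⊢ a ∶ int) (v≡ : V ⟪ slot ρ ⟫ ≡ v) where
    private
      Z : Term
      Z = (lam j int M ⟪ slot ρ ⟫) · v

      tZ : [] ⊢ Z ∶ σ
      tZ = tapp (toCtx-⟪⟫-⊢ {Δ} (toCtx-lam {Δ} t) ts)
                (subst ([] ⊢_∶ int) v≡ (toCtx-⟪⟫-⊢ {Δ} tV ts))

      unfold : testAssign σ i j V M ⟪ slot ρ ⟫ ≡ test σ a Z
      unfold = cong₂ _·_ (cong₂ _·_ (⟪⟫-fresh (force-⊢ {[]} σ) λ ()) (var-slot {ρ} i u))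
                         (cong (_ ·_) v≡)

    testAssign-steps : ∀ {m} → a ↠PCF num m → (testAssign σ i j V M ⟪ slot ρ ⟫) PCF.∙ T ↠PCF
      (M ⟪ slot ((ρ [ i ≔ just a ]) [ j ≔ just v ]) ⟫) PCF.∙ T
    -- In PCF the tested operand stays as it is, so writing `a` back to register `i` changes
    -- nothing.
    testAssign-steps r rewrite unfold | update-slot ρ i u =
      test-steps ta tZ args r ◅◅ PCF.∙-steps T (assign-steps t ts)

    testAssign-strict : ∀ {k n} → (testAssign σ i j V M ⟪ slot ρ ⟫) PCF.∙ T PCF.⟶⟨ k ⟩ num n →
      ∃₂ λ l m → l ≤ k × a PCF.⟶⟨ l ⟩ num m
    testAssign-strict r rewrite unfold = test-strict ta tZ args r

module _ {𝔸 : Set} {num𝔸 : ℕ → 𝔸} (tbl : AddressTable 𝔸 num𝔸) where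
  -- The code depends on the derivation: `lam` needs the type of the register that is overwritten,
  -- and `force` needs the result type.
  actCode : ∀ {Δ A σ} → _⊢ᴬ_∶_ tbl Δ A σ → Term
  actCode (tApp {i = i} {j} {k} {ρ = υ} _ _ d) = lam k υ (actCode d) · (var i · var j)
  actCode (tPred {i = i} {j} {σ = σ} _ d) = testAssign σ i j (pred (var i)) (actCode d)
  actCode (tSucc {i = i} {j} {σ = σ} _ d) = testAssign σ i j (succ (var i)) (actCode d)
  actCode (tIfz {i = i} {j} {k} {l} {σ = σ} _ _ _ d) =
    testAssign σ i l (ifz (var i) (var j) (var k)) (actCode d)
  actCode (tCall {i = i} _) = var i

  progCode : ∀ {Δ P σ} → _⊢ᴾ_∶_ tbl Δ P σ → Term
  progCode (tLoad {i = i} {τ = τ} d) = lam i τ (progCode d)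
  progCode (tAct d) = actCode d

  actCode-⊢ : ∀ {Δ A σ} (d : _⊢ᴬ_∶_ tbl Δ A σ) → toCtx Δ ⊢ actCode d ∶ σ
  actCode-⊢ {Δ} (tApp p q d) =
    tapp (toCtx-lam {Δ} (actCode-⊢ d)) (tapp (toCtx-var {Δ} p) (toCtx-var {Δ} q))
  actCode-⊢ {Δ} (tPred p d) = testAssign-⊢ {Δ} p (tpred (toCtx-var {Δ} p)) (actCode-⊢ d)
  actCode-⊢ {Δ} (tSucc p d) = testAssign-⊢ {Δ} p (tsucc (toCtx-var {Δ} p)) (actCode-⊢ d)
  actCode-⊢ {Δ} (tIfz p q r d) = testAssign-⊢ {Δ} p
    (tifz (toCtx-var {Δ} p) (toCtx-var {Δ} q) (toCtx-var {Δ} r)) (actCode-⊢ d)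
  actCode-⊢ {Δ} (tCall p) = toCtx-var {Δ} p

  progCode-⊢ : ∀ {Δ P σ} (d : _⊢ᴾ_∶_ tbl Δ P σ) → toCtx Δ ⊢ progCode d ∶ σ
  progCode-⊢ {Δ} (tLoad d) = toCtx-lam {Δ} (progCode-⊢ d)
  progCode-⊢ (tAct d) = actCode-⊢ d

  pcfProgs : ProgModel tbl pcf
  pcfProgs = record
    { ⟦_⟧ᴾ = λ d ρ → progCode d ⟪ slot ρ ⟫
    ; ⟦_⟧ᴬ = λ d ρ → actCode d ⟪ slot ρ ⟫
    ; ᴾ-Typ = λ {Δ} d → toCtx-⟪⟫-⊢ {Δ} (progCode-⊢ d)
    ; load-step = λ d ts _ → assign-steps (progCode-⊢ d) ts
    ; act-step = λ _ → ε
    ; call-step = λ {Δ} {i} {σ} {ρ} _ u → ≡⇒↠PCF (var-slot {ρ} i u)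
    ; app-step = λ {Δ} {i} {j} {k} {ρ = ρ} p q d ts u u′ _ _ →
        ≡⇒↠PCF (cong₂ (λ M N → _ · (M · N)) (var-slot {ρ} i u) (var-slot {ρ} j u′))
        ◅◅ assign-steps (actCode-⊢ d) ts
    ; operand = λ a _ → a
    ; predecessor = λ a _ → pred a
    ; successor = λ a _ → succ a
    ; branch = λ a b c _ → ifz a b c
    ; operand-Typ = id
    ; predecessor-Typ = tpred
    ; successor-Typ = tsucc
    ; branch-Typ = tifz
    ; operand-value = id
    ; predecessor-value = pred-steps
    ; successor-value = succ-steps
    ; branch-zero = ifz-steps-0
    ; branch-suc = ifz-steps-suc
    ; pred-step = λ {Δ} {i} {ρ = ρ} p d ts args u ta →
        testAssign-steps p (tpred (toCtx-var {Δ} p)) (actCode-⊢ d) ts args u ta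
          (cong pred (var-slot {ρ} i u))
    ; pred-strict = λ {Δ} p d ts args u ta →
        testAssign-strict p (tpred (toCtx-var {Δ} p)) (actCode-⊢ d) ts args u ta refl
    ; succ-step = λ {Δ} {i} {ρ = ρ} p d ts args u ta →
        testAssign-steps p (tsucc (toCtx-var {Δ} p)) (actCode-⊢ d) ts args u ta
          (cong succ (var-slot {ρ} i u))
    ; succ-strict = λ {Δ} p d ts args u ta →
        testAssign-strict p (tsucc (toCtx-var {Δ} p)) (actCode-⊢ d) ts args u ta refl
    ; ifz-step = λ {Δ} {i} {j} {k} {ρ = ρ} p q r d ts args u u₀ u₁ ta →
        testAssign-steps p (tifz (toCtx-var {Δ} p) (toCtx-var {Δ} q) (toCtx-var {Δ} r))
          (actCode-⊢ d) ts args u ta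
          (cong-ifz (var-slot {ρ} i u)
            (var-slot {ρ} j (subst (λ ρ → slot ρ j ≡ _) (update-slot ρ i u) u₀))
            (var-slot {ρ} k (subst (λ ρ → slot ρ k ≡ _) (update-slot ρ i u) u₁)))
    ; ifz-strict = λ {Δ} p q r d ts args u ta →
        testAssign-strict p (tifz (toCtx-var {Δ} p) (toCtx-var {Δ} q) (toCtx-var {Δ} r))
          (actCode-⊢ d) ts args u ta refl
    ; fixpoint = λ α → lam 0 (α ⇒ α) (fix (var 0))
    ; fixpoint-Typ = tlam (tfix (tvar refl))
    ; fixpoint-step = λ _ → beta ◅ ε
    }

-- Contexts

-- The annotations on `lam` determine the type. At the hole of a typable `plug C P` this forces the
-- type used there to be the given type of `P`, so that a variable of that type can stand in for
-- `P`.
typ-unique : ∀ {Γ M α β} → Γ ⊢ M ∶ α → Γ ⊢ M ∶ β → α ≡ β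
typ-unique (tvar p) (tvar q) = just-injective (trans (sym p) q)
typ-unique (tlam t) (tlam u) = cong (_ ⇒_) (typ-unique t u)
typ-unique (tapp t _) (tapp u _) with refl ← typ-unique t u = refl
typ-unique tnum tnum = refl
typ-unique (tpred _) (tpred _) = refl
typ-unique (tsucc _) (tsucc _) = refl
typ-unique (tifz _ _ _) (tifz _ _ _) = refl
typ-unique (tfix t) (tfix u) with refl ← typ-unique t u = refl

-- Only binders with the hole in their scope can capture there, so the other subterms are skipped.
-- The bound is exclusive because of `suc x`, and is therefore itself a safe name.
binderBound : Context → ℕ
binderBound hole = 0
binderBound (lamC x _ C) = suc x ⊔ binderBound C
binderBound (appCL C _) = binderBound C
binderBound (appCR _ C) = binderBound C
binderBound (predC C) = binderBound C
binderBound (succC C) = binderBound C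
binderBound (ifzC₁ C _ _) = binderBound C
binderBound (ifzC₂ _ C _) = binderBound C
binderBound (ifzC₃ _ _ C) = binderBound C
binderBound (fixC C) = binderBound C

≡ᵇ-refl : ∀ x → (x ≡ᵇ x) ≡ true
≡ᵇ-refl zero = refl
≡ᵇ-refl (suc x) = ≡ᵇ-refl x

<⇒≡ᵇ-false : ∀ {x z} → x < z → (z ≡ᵇ x) ≡ false
<⇒≡ᵇ-false {zero} (s≤s _) = refl
<⇒≡ᵇ-false {suc x} (s≤s x<z) = <⇒≡ᵇ-false x<z

-- `Γ⁺` is meant as `Γ` with `z` added at the outermost place; describing it by inclusion and lookup
-- lets it pass under the binders of `C`.
plug-var-⊢ : ∀ C {Γ Γ⁺ z P α β} → (∀ {x τ} → lookupT Γ x ≡ just τ → lookupT Γ⁺ x ≡ just τ) →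
  lookupT Γ⁺ z ≡ just α → binderBound C ≤ z → [] ⊢ P ∶ α → Γ ⊢ plug C P ∶ β →
  Γ⁺ ⊢ plug C (var z) ∶ β
plug-var-⊢ hole h p le t u with refl ← typ-unique (weaken-closed t) u = tvar p
plug-var-⊢ (lamC x σ C) {Γ} {Γ⁺} {z} {α = α} h p le t (tlam u) =
  tlam (plug-var-⊢ C h′ p′ (m⊔n≤o⇒n≤o (suc x) (binderBound C) le) t u)
  where
  h′ : ∀ {w τ} → lookupT ((x , σ) ∷ Γ) w ≡ just τ → lookupT ((x , σ) ∷ Γ⁺) w ≡ just τ
  h′ {w} eq with w ≡ᵇ x
  ... | true = eq
  ... | false = h eq
  p′ : lookupT ((x , σ) ∷ Γ⁺) z ≡ just α
  p′ rewrite <⇒≡ᵇ-false (m⊔n≤o⇒m≤o (suc x) (binderBound C) le) = p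
plug-var-⊢ (appCL C N) h p le t (tapp u v) = tapp (plug-var-⊢ C h p le t u) (weaken h v)
plug-var-⊢ (appCR M C) h p le t (tapp u v) = tapp (weaken h u) (plug-var-⊢ C h p le t v)
plug-var-⊢ (predC C) h p le t (tpred u) = tpred (plug-var-⊢ C h p le t u)
plug-var-⊢ (succC C) h p le t (tsucc u) = tsucc (plug-var-⊢ C h p le t u)
plug-var-⊢ (ifzC₁ C M N) h p le t (tifz u v w) =
  tifz (plug-var-⊢ C h p le t u) (weaken h v) (weaken h w)
plug-var-⊢ (ifzC₂ L C N) h p le t (tifz u v w) =
  tifz (weaken h u) (plug-var-⊢ C h p le t v) (weaken h w)
plug-var-⊢ (ifzC₃ L M C) h p le t (tifz u v w) =
  tifz (weaken h u) (weaken h v) (plug-var-⊢ C h p le t w)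
plug-var-⊢ (fixC C) h p le t (tfix u) = tfix (plug-var-⊢ C h p le t u)

plug-var-⟪⟫ : ∀ C {Γ s z P β} → Γ ⊢ plug C P ∶ β →
  (∀ {x τ} → lookupT Γ x ≡ just τ → s x ≡ nothing) → s z ≡ just P → binderBound C ≤ z →
  plug C (var z) ⟪ s ⟫ ≡ plug C P
plug-var-⟪⟫ hole u h p le = cong (fromMaybe _) p
plug-var-⟪⟫ (lamC x σ C) {Γ} {s} {z} {P} (tlam u) h p le =
  cong (lam x σ) (plug-var-⟪⟫ C u h′ p′ (m⊔n≤o⇒n≤o (suc x) (binderBound C) le))
  where
  h′ : ∀ {w τ} → lookupT ((x , σ) ∷ Γ) w ≡ just τ → (s ∖ x) w ≡ nothing
  h′ {w} eq with w ≡ᵇ x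
  ... | true = refl
  ... | false = h eq
  p′ : (s ∖ x) z ≡ just P
  p′ rewrite <⇒≡ᵇ-false (m⊔n≤o⇒m≤o (suc x) (binderBound C) le) = p
plug-var-⟪⟫ (appCL C N) (tapp u v) h p le = cong₂ _·_ (plug-var-⟪⟫ C u h p le) (⟪⟫-fresh v h)
plug-var-⟪⟫ (appCR M C) (tapp u v) h p le = cong₂ _·_ (⟪⟫-fresh u h) (plug-var-⟪⟫ C v h p le)
plug-var-⟪⟫ (predC C) (tpred u) h p le = cong pred (plug-var-⟪⟫ C u h p le)
plug-var-⟪⟫ (succC C) (tsucc u) h p le = cong succ (plug-var-⟪⟫ C u h p le)
plug-var-⟪⟫ (ifzC₁ C M N) (tifz u v w) h p le =
  cong-ifz (plug-var-⟪⟫ C u h p le) (⟪⟫-fresh v h) (⟪⟫-fresh w h)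
plug-var-⟪⟫ (ifzC₂ L C N) (tifz u v w) h p le =
  cong-ifz (⟪⟫-fresh u h) (plug-var-⟪⟫ C v h p le) (⟪⟫-fresh w h)
plug-var-⟪⟫ (ifzC₃ L M C) (tifz u v w) h p le =
  cong-ifz (⟪⟫-fresh u h) (⟪⟫-fresh v h) (plug-var-⟪⟫ C w h p le)
plug-var-⟪⟫ (fixC C) (tfix u) h p le = cong fix (plug-var-⟪⟫ C u h p le)

_⟨appCL_⟩ : Context → Term → Context
hole ⟨appCL N ⟩ = appCL hole N
lamC x σ C ⟨appCL N ⟩ = lamC x σ (C ⟨appCL N ⟩)
appCL C M ⟨appCL N ⟩ = appCL (C ⟨appCL N ⟩) M
appCR M C ⟨appCL N ⟩ = appCR M (C ⟨appCL N ⟩)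
predC C ⟨appCL N ⟩ = predC (C ⟨appCL N ⟩)
succC C ⟨appCL N ⟩ = succC (C ⟨appCL N ⟩)
ifzC₁ C L M ⟨appCL N ⟩ = ifzC₁ (C ⟨appCL N ⟩) L M
ifzC₂ L C M ⟨appCL N ⟩ = ifzC₂ L (C ⟨appCL N ⟩) M
ifzC₃ L M C ⟨appCL N ⟩ = ifzC₃ L M (C ⟨appCL N ⟩)
fixC C ⟨appCL N ⟩ = fixC (C ⟨appCL N ⟩)

plug-⟨appCL⟩ : ∀ C N P → plug (C ⟨appCL N ⟩) P ≡ plug C (P · N)
plug-⟨appCL⟩ hole N P = refl
plug-⟨appCL⟩ (lamC x σ C) N P = cong (lam x σ) (plug-⟨appCL⟩ C N P)
plug-⟨appCL⟩ (appCL C M) N P = cong (_· M) (plug-⟨appCL⟩ C N P)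
plug-⟨appCL⟩ (appCR M C) N P = cong (M ·_) (plug-⟨appCL⟩ C N P)
plug-⟨appCL⟩ (predC C) N P = cong pred (plug-⟨appCL⟩ C N P)
plug-⟨appCL⟩ (succC C) N P = cong succ (plug-⟨appCL⟩ C N P)
plug-⟨appCL⟩ (ifzC₁ C L M) N P = cong (λ K → ifz K L M) (plug-⟨appCL⟩ C N P)
plug-⟨appCL⟩ (ifzC₂ L C M) N P = cong (λ K → ifz L K M) (plug-⟨appCL⟩ C N P)
plug-⟨appCL⟩ (ifzC₃ L M C) N P = cong (ifz L M) (plug-⟨appCL⟩ C N P)
plug-⟨appCL⟩ (fixC C) N P = cong fix (plug-⟨appCL⟩ C N P)

-- The argument `N` is moved from the hole into the context.
≡obs-app : ∀ {P P′} → P ≡obs P′ → ∀ N → (P · N) ≡obs (P′ · N)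
≡obs-app {P} {P′} e N C with plug C (P · N) | plug-⟨appCL⟩ C N P
... | _ | refl with plug C (P′ · N) | plug-⟨appCL⟩ C N P′
... | _ | refl = e (C ⟨appCL N ⟩)

-- Machines

⇛-++ : ∀ τs {υs α} → (τs ++ υs) ⇛ α ≡ τs ⇛ (υs ⇛ α)
⇛-++ [] = refl
⇛-++ (τ ∷ τs) = cong (τ ⇒_) (⇛-++ τs)

⊲-identityʳ : ∀ {A : Set} (M : EAM A) → M ⊲ [] ≡ M
⊲-identityʳ (numeral n) = refl
⊲-identityʳ ⟨ R , P , T ⟩ = cong ⟨ R , P ,_⟩ (++-identityʳ T)

⊲-assoc : ∀ {A : Set} (M : EAM A) T T′ → (M ⊲ T) ⊲ T′ ≡ M ⊲ (T ++ T′)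
⊲-assoc (numeral n) T T′ = refl
⊲-assoc ⟨ R , P , T₀ ⟩ T T′ = cong ⟨ R , P ,_⟩ (++-assoc T₀ T T′)

-- Environments as tapes, and tapes loaded into registers

module _ {A : Set} where
  -- Environments list the newest binding first, while `Tr` and the tape follow binding order; hence
  -- the reversal here and in `values`.
  names : List (ℕ × A) → List ℕ
  names [] = []
  names ((x , _) ∷ γ) = names γ ++ (x ∷ [])

  values : List (ℕ × A) → List A
  values [] = []
  values ((_ , a) ∷ γ) = values γ ++ (a ∷ [])

  length-names : ∀ γ → length (names γ) ≡ length (values γ)
  length-names [] = refl
  length-names ((x , a) ∷ γ) = trans (length-++ (names γ))
    (trans (cong (_+ 1) (length-names γ)) (sym (length-++ (values γ))))

  ‼-++ : ∀ (xs : List A) {ys i a} → xs ‼ i ≡ just a → (xs ++ ys) ‼ i ≡ just a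
  ‼-++ (_ ∷ xs) {i = zero} eq = eq
  ‼-++ (_ ∷ xs) {i = suc i} eq = ‼-++ xs eq

  ‼-snoc : ∀ (xs : List A) {a} → (xs ++ (a ∷ [])) ‼ length xs ≡ just a
  ‼-snoc [] = refl
  ‼-snoc (_ ∷ xs) = ‼-snoc xs

  fill : List (Maybe A) → ℕ → List A → List (Maybe A)
  fill R b [] = R
  fill R b (a ∷ as) = fill (R [ b ≔ just a ]) (suc b) as

  data Slots (R : List (Maybe A)) : ℕ → List A → Set where
    []  : ∀ {b} → Slots R b []
    _∷_ : ∀ {b a as} → slot R b ≡ just a → Slots R (suc b) as → Slots R b (a ∷ as)

  length-update : ∀ (R : List (Maybe A)) i {a} → length (R [ i ≔ a ]) ≡ length R
  length-update [] i = refl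
  length-update (_ ∷ R) zero = refl
  length-update (_ ∷ R) (suc i) = cong suc (length-update R i)

  slot-update-< : ∀ (R : List (Maybe A)) i {a} → i < length R → slot (R [ i ≔ just a ]) i ≡ just a
  slot-update-< (_ ∷ R) zero _ = refl
  slot-update-< (_ ∷ R) (suc i) (s≤s i<l) = slot-update-< R i i<l

  slot-fill-< : ∀ {R b r} as → r < b → slot (fill R b as) r ≡ slot R r
  slot-fill-< [] r<b = refl
  slot-fill-< {R} {b} {r} (a ∷ as) r<b =
    trans (slot-fill-< as (m<n⇒m<1+n r<b)) (slot-update-≢ R b r (>⇒≢ r<b))

  fill-Slots : ∀ {R b} as → b + length as ≤ length R → Slots (fill R b as) b as
  fill-Slots [] _ = []
  fill-Slots {R} {b} (a ∷ as) le =
    trans (slot-fill-< as ≤-refl) (slot-update-< R b (≤-trans (s≤s (m≤m+n b _)) le′)) ∷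
    fill-Slots as (subst (suc b + length as ≤_) (sym (length-update R b)) le′)
    where
    le′ : suc (b + length as) ≤ length R
    le′ = subst (_≤ length R) (+-suc b (length as)) le

  Slots-update : ∀ {R b as r a} → r < b → Slots R b as → Slots (R [ r ≔ a ]) b as
  Slots-update r<b [] = []
  Slots-update {R} {b} {r = r} r<b (p ∷ ps) =
    trans (slot-update-≢ R r b (<⇒≢ r<b)) p ∷ Slots-update (m<n⇒m<1+n r<b) ps

  Slots-‼ : ∀ {R b as i a} → Slots R b as → as ‼ i ≡ just a → slot R (b + i) ≡ just a
  Slots-‼ {R} {b} {i = zero} (p ∷ ps) refl = trans (cong (slot R) (+-identityʳ b)) p
  Slots-‼ {R} {b} {i = suc i} (p ∷ ps) eq = trans (cong (slot R) (+-suc b i)) (Slots-‼ ps eq)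

  ‼-Slots : ∀ {R b} as → (∀ {i a} → as ‼ i ≡ just a → slot R (b + i) ≡ just a) → Slots R b as
  ‼-Slots [] h = []
  ‼-Slots {R} {b} (a ∷ as) h = trans (cong (slot R) (sym (+-identityʳ b))) (h refl) ∷
    ‼-Slots as λ {i} eq → trans (cong (slot R) (sym (+-suc b i))) (h eq)

  ‼⇒< : ∀ (as : List A) {i a} → as ‼ i ≡ just a → i < length as
  ‼⇒< (_ ∷ as) {zero} _ = s≤s z≤n
  ‼⇒< (_ ∷ as) {suc i} eq = s≤s (‼⇒< as eq)

  length-fill : ∀ R {b} as → length (fill R b as) ≡ length R
  length-fill R [] = refl
  length-fill R {b} (a ∷ as) = trans (length-fill (R [ b ≔ just a ]) as) (length-update R b)

module Machines {𝔸 : Set} {num𝔸 : ℕ → 𝔸} (tbl : AddressTable 𝔸 num𝔸) where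
  open AddressTable tbl

  infix 4 _⟶ᶜ_ _↠ᶜ_ _∶_
  _⟶ᶜ_ _↠ᶜ_ : EAM 𝔸 → EAM 𝔸 → Set
  _⟶ᶜ_ = _→c_ tbl
  _↠ᶜ_ = Star _⟶ᶜ_

  _∶_ : EAM 𝔸 → Ty → Set
  _∶_ = _∶ᴹ_ tbl

  numeral-normal : ∀ {M n N} → M ≡ numeral n → ¬ (M ⟶ᶜ N)
  numeral-normal refl ()

  just-unique : ∀ {m : Maybe 𝔸} {a b} → m ≡ just a → m ≡ just b → a ≡ b
  just-unique p q = just-injective (trans (sym p) q)

  numeral-unique : ∀ {M : EAM 𝔸} {m n} → M ≡ numeral m → M ≡ numeral n → m ≡ n
  numeral-unique refl refl = refl

  ⟶ᶜ-deterministic : ∀ {M N N′} → M ⟶ᶜ N → M ⟶ᶜ N′ → N ≡ N′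
  ⟶ᶜ-deterministic load load = refl
  ⟶ᶜ-deterministic (app p q) (app p′ q′)
    with refl ← just-unique p p′ | refl ← just-unique q q′ = refl
  ⟶ᶜ-deterministic (predN p q) (predN p′ q′)
    with refl ← just-unique p p′ with refl ← numeral-unique q q′ = refl
  ⟶ᶜ-deterministic (predN p q) (predR p′ s)
    with refl ← just-unique p p′ = contradiction s (numeral-normal q)
  ⟶ᶜ-deterministic (predR p s) (predN p′ q)
    with refl ← just-unique p p′ = contradiction s (numeral-normal q)
  ⟶ᶜ-deterministic (predR p s) (predR p′ s′)
    with refl ← just-unique p p′ with refl ← ⟶ᶜ-deterministic s s′ = refl
  ⟶ᶜ-deterministic (succN p q) (succN p′ q′)
    with refl ← just-unique p p′ with refl ← numeral-unique q q′ = refl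
  ⟶ᶜ-deterministic (succN p q) (succR p′ s)
    with refl ← just-unique p p′ = contradiction s (numeral-normal q)
  ⟶ᶜ-deterministic (succR p s) (succN p′ q)
    with refl ← just-unique p p′ = contradiction s (numeral-normal q)
  ⟶ᶜ-deterministic (succR p s) (succR p′ s′)
    with refl ← just-unique p p′ with refl ← ⟶ᶜ-deterministic s s′ = refl
  ⟶ᶜ-deterministic (ifz0 p q r) (ifz0 p′ q′ r′)
    with refl ← just-unique p p′ | refl ← just-unique r r′ = refl
  ⟶ᶜ-deterministic (ifz0 p q r) (ifzS p′ q′ r′)
    with refl ← just-unique p p′ with () ← numeral-unique q q′
  ⟶ᶜ-deterministic (ifz0 p q r) (ifzR p′ s)
    with refl ← just-unique p p′ = contradiction s (numeral-normal q)
  ⟶ᶜ-deterministic (ifzS p q r) (ifz0 p′ q′ r′)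
    with refl ← just-unique p p′ with () ← numeral-unique q q′
  ⟶ᶜ-deterministic (ifzS p q r) (ifzS p′ q′ r′)
    with refl ← just-unique p p′ | refl ← just-unique r r′ = refl
  ⟶ᶜ-deterministic (ifzS p q r) (ifzR p′ s)
    with refl ← just-unique p p′ = contradiction s (numeral-normal q)
  ⟶ᶜ-deterministic (ifzR p s) (ifz0 p′ q r)
    with refl ← just-unique p p′ = contradiction s (numeral-normal q)
  ⟶ᶜ-deterministic (ifzR p s) (ifzS p′ q r)
    with refl ← just-unique p p′ = contradiction s (numeral-normal q)
  ⟶ᶜ-deterministic (ifzR p s) (ifzR p′ s′)
    with refl ← just-unique p p′ with refl ← ⟶ᶜ-deterministic s s′ = refl
  ⟶ᶜ-deterministic (call p) (call p′) with refl ← just-unique p p′ = refl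

  ⊲-step : ∀ {M N} T → M ⟶ᶜ N → M ⊲ T ⟶ᶜ N ⊲ T
  ⊲-step T load = load
  ⊲-step T (app p q) = app p q
  ⊲-step T (predN p q) = predN p q
  ⊲-step T (predR p s) = predR p s
  ⊲-step T (succN p q) = succN p q
  ⊲-step T (succR p s) = succR p s
  ⊲-step T (ifz0 p q r) = ifz0 p q r
  ⊲-step T (ifzS p q r) = ifzS p q r
  ⊲-step T (ifzR p s) = ifzR p s
  ⊲-step T (call {T = T₀} {a} p) = subst (_ ⟶ᶜ_) (sym (⊲-assoc (#⁻¹ a) T₀ T)) (call p)

  #-step : ∀ {M N} → M ⟶ᶜ N → #⁻¹ (# M) ⟶ᶜ #⁻¹ (# N)
  #-step = subst₂ _⟶ᶜ_ (sym (#⁻¹# _)) (sym (#⁻¹# _))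

  #-injective : ∀ {M N} → # M ≡ # N → M ≡ N
  #-injective eq = trans (sym (#⁻¹# _)) (trans (cong #⁻¹ eq) (#⁻¹# _))

  #⁻¹-injective : ∀ {a b} → #⁻¹ a ≡ #⁻¹ b → a ≡ b
  #⁻¹-injective eq = trans (sym (##⁻¹ _)) (trans (cong # eq) (##⁻¹ _))

  TapeTy-++ : ∀ {T T′ τs υs} → TapeTy tbl T τs → TapeTy tbl T′ υs →
    TapeTy tbl (T ++ T′) (τs ++ υs)
  TapeTy-++ [] us = us
  TapeTy-++ (t ∷ ts) us = t ∷ TapeTy-++ ts us

  ⊲-Typ : ∀ {M α T} τs → M ∶ (τs ⇛ α) → TapeTy tbl T τs → M ⊲ T ∶ α
  ⊲-Typ {M} [] D [] = subst (_∶ _) (sym (⊲-identityʳ M)) D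
  ⊲-Typ (_ ∷ _) (tMach {τs = τs} rs d ts) us =
    tMach rs (subst (_⊢ᴾ_∶_ tbl _ _) (sym (⇛-++ τs)) d) (TapeTy-++ ts us)
  ⊲-Typ (_ ∷ _) (tY {τs = τs} eq ts) us =
    tY (trans eq (sym (⇛-++ τs))) (TapeTy-++ ts us)

  ·ᴬ-Typ : ∀ {α β a b} → 𝒟 tbl (α ⇒ β) a → 𝒟 tbl α b → 𝒟 tbl β (_·ᴬ_ tbl a b)
  ·ᴬ-Typ {α} D E = subst (_∶ _) (sym (#⁻¹# _)) (⊲-Typ (α ∷ []) D (E ∷ []))

  y-Typ : ∀ {α} → 𝒟 tbl ((α ⇒ α) ⇒ α) y
  y-Typ = subst (_∶ _) (sym #⁻¹y) (tY {τs = []} refl [])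

  call-identity : ∀ {R i a} → slot R i ≡ just a → ⟨ R , act (Call i) , [] ⟩ ⟶ᶜ #⁻¹ a
  call-identity {a = a} p = subst (_ ⟶ᶜ_) (⊲-identityʳ (#⁻¹ a)) (call p)

  y-step : ∀ f → ∃ λ M → (#⁻¹ (_·ᴬ_ tbl y f) ⟶ᶜ M) × (M ↠ᶜ #⁻¹ (_·ᴬ_ tbl f (_·ᴬ_ tbl y f)))
  y-step f = _ , subst (λ M → M ⟶ᶜ ⟨ just y ∷ just f ∷ [] , act (App 0 1 0 (App 1 0 0 (Call 0))) , [] ⟩)
    (sym y·f) load ,
    -- The first `App` rebuilds `y · f` in register 0 from the stored address `y`, the second turns
    -- it into `f · (y · f)`, and `Call 0` jumps there.
    app refl refl ◅ app refl refl ◅ call-identity refl ◅ ε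
    where
    y·f : #⁻¹ (_·ᴬ_ tbl y f) ≡ ⟨ Yregs y , Yprog , f ∷ [] ⟩
    y·f = trans (#⁻¹# _) (cong (_⊲ (f ∷ [])) #⁻¹y)

  #-steps : ∀ {a M} → #⁻¹ a ↠ᶜ M → Star (λ a b → #⁻¹ a ⟶ᶜ #⁻¹ b) a (# M)
  #-steps r = subst (λ a → Star _ a _) (##⁻¹ _) (gmap # #-step r)

  -- Addresses form the carrier because registers, tapes and application deal in addresses;
  -- bijectivity of the table carries steps of machines over to them.
  machines : World
  machines = record
    { Carrier = 𝔸
    ; _⊙_ = _·ᴬ_ tbl
    ; nm = λ n → # (numeral n)
    ; fixp = _·ᴬ_ tbl y
    ; Typ = 𝒟 tbl
    ; _⟶_ = λ a b → #⁻¹ a ⟶ᶜ #⁻¹ b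
    ; deterministic = λ s s′ → #⁻¹-injective (⟶ᶜ-deterministic s s′)
    ; nm-normal = numeral-normal (#⁻¹# _)
    ; nm-injective = λ eq → numeral-unique refl (#-injective eq)
    ; ⊙-stepˡ = λ s → #-step (⊲-step _ s)
    ; fixp-unfold = λ f → let M , s , r = y-step f in
        # M , subst (#⁻¹ (_·ᴬ_ tbl y f) ⟶ᶜ_) (sym (#⁻¹# M)) s ,
        subst (Star _ (# M)) (##⁻¹ _) (gmap # #-step r)
    ; nm-Typ = subst (_∶ int) (sym (#⁻¹# _)) tNum
    ; ⊙-Typ = ·ᴬ-Typ
    ; fixp-Typ = ·ᴬ-Typ y-Typ
    }

  open World machines public

  #-↠ : ∀ {M N} → M ↠ᶜ N → # M ↠ # N
  #-↠ = gmap # #-step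

  #⁻¹-↠ : ∀ {a n} → a ↠ nm n → #⁻¹ a ↠ᶜ numeral n
  #⁻¹-↠ r = subst (Star _ _) (#⁻¹# _) (gmap #⁻¹ id r)

  ∙-⊲ : ∀ a T → a ∙ T ≡ # (#⁻¹ a ⊲ T)
  ∙-⊲ a [] = sym (trans (cong # (⊲-identityʳ (#⁻¹ a))) (##⁻¹ a))
  ∙-⊲ a (b ∷ T) = trans (∙-⊲ (a ⊙ b) T)
    (cong # (trans (cong (_⊲ T) (#⁻¹# _)) (⊲-assoc (#⁻¹ a) (b ∷ []) T)))

  #-∙ : ∀ M T → # M ∙ T ≡ # (M ⊲ T)
  #-∙ M T = trans (∙-⊲ (# M) T) (cong (λ N → # (N ⊲ T)) (#⁻¹# M))

  lower : ∀ {M T k n} → # M ∙ T ⟶⟨ k ⟩ nm n → Iter _⟶ᶜ_ k (M ⊲ T) (numeral n)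
  lower {M} {T} r = subst₂ (Iter _⟶ᶜ_ _) (trans (cong #⁻¹ (#-∙ M T)) (#⁻¹# _)) (#⁻¹# _)
    (Iter-map #⁻¹ id r)

  raise : ∀ {a k n} → Iter _⟶ᶜ_ k (#⁻¹ a) (numeral n) → a ⟶⟨ k ⟩ nm n
  raise r = subst (λ a → a ⟶⟨ _ ⟩ _) (##⁻¹ _) (Iter-map # #-step r)

  -- Instructions that evaluate a register in place

  TestsRegister : ℕ → Act → Set
  TestsRegister i B = ∀ {R T M} → ⟨ R , act B , T ⟩ ⟶ᶜ M →
    (∃₂ λ a n → slot R i ≡ just a × #⁻¹ a ≡ numeral n) ⊎
    (∃₂ λ a N → slot R i ≡ just a × (#⁻¹ a ⟶ᶜ N) × M ≡ ⟨ R [ i ≔ just (# N) ] , act B , T ⟩)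

  -- Until the register holds a numeral, each step of the machine is one step of the register's
  -- content, so the content converges no later than the whole.
  tests-strict : ∀ {i B R T a k n} → TestsRegister i B → slot R i ≡ just a →
    Iter _⟶ᶜ_ k ⟨ R , act B , T ⟩ (numeral n) →
    ∃₂ λ l m → l ≤ k × Iter _⟶ᶜ_ l (#⁻¹ a) (numeral m)
  tests-strict {i} {B} {R} h p (step s r) with h s
  ... | inj₁ (_ , n , p′ , q) with refl ← just-unique p p′ =
    0 , n , z≤n , subst (Iter _⟶ᶜ_ 0 _) q done
  ... | inj₂ (_ , N , p′ , s′ , refl)
    with refl ← just-unique p p′
    with l , m , l≤k , r′ ← tests-strict {i} {B} h (slot-update R i p) r =
    suc l , m , s≤s l≤k , step s′ (subst (λ M → Iter _⟶ᶜ_ l M _) (#⁻¹# N) r′)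

  -- `M` is kept apart from `#⁻¹ a` so that the induction follows a run of machines while the
  -- register stores their addresses.
  evaluate-operand : ∀ {i B R T a M m} →
    (∀ {R a N} → slot R i ≡ just a → #⁻¹ a ⟶ᶜ N →
      ⟨ R , act B , T ⟩ ⟶ᶜ ⟨ R [ i ≔ just (# N) ] , act B , T ⟩) →
    slot R i ≡ just a → #⁻¹ a ≡ M → M ↠ᶜ numeral m →
    ⟨ R , act B , T ⟩ ↠ᶜ ⟨ R [ i ≔ just (nm m) ] , act B , T ⟩
  evaluate-operand {i} {R = R} h p eq ε
    rewrite update-slot R i (trans p (cong just (#⁻¹-injective (trans eq (sym (#⁻¹# _)))))) = ε
  evaluate-operand {i} {B} {R} {T} h p refl (_◅_ {j = N} s r) =
    h p s ◅ subst (λ R → _ ↠ᶜ ⟨ R , act B , T ⟩) (update-update R i)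
      (evaluate-operand h (slot-update R i p) (#⁻¹# N) r)

  Pred-tests : ∀ {i j A} → TestsRegister i (Pred i j A)
  Pred-tests (predN p q) = inj₁ (_ , _ , p , q)
  Pred-tests (predR p s) = inj₂ (_ , _ , p , s , refl)

  Succ-tests : ∀ {i j A} → TestsRegister i (Succ i j A)
  Succ-tests (succN p q) = inj₁ (_ , _ , p , q)
  Succ-tests (succR p s) = inj₂ (_ , _ , p , s , refl)

  Ifz-tests : ∀ {i j k l A} → TestsRegister i (Ifz i j k l A)
  Ifz-tests (ifz0 p q _) = inj₁ (_ , _ , p , q)
  Ifz-tests (ifzS p q _) = inj₁ (_ , _ , p , q)
  Ifz-tests (ifzR p s) = inj₂ (_ , _ , p , s , refl)

  Pred-steps : ∀ {R i j A T a m} → slot R i ≡ just a → a ↠ nm m →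
    ⟨ R , act (Pred i j A) , T ⟩ ↠ᶜ
    ⟨ (R [ i ≔ just (nm m) ]) [ j ≔ just (nm (m ∸ 1)) ] , act A , T ⟩
  Pred-steps {R} {i} {m = m} p r rewrite #num (m ∸ 1) =
    evaluate-operand predR p refl (#⁻¹-↠ r) ◅◅ predN (slot-update R i p) (#⁻¹# _) ◅ ε

  Succ-steps : ∀ {R i j A T a m} → slot R i ≡ just a → a ↠ nm m →
    ⟨ R , act (Succ i j A) , T ⟩ ↠ᶜ
    ⟨ (R [ i ≔ just (nm m) ]) [ j ≔ just (nm (suc m)) ] , act A , T ⟩
  Succ-steps {R} {i} {m = m} p r rewrite #num (suc m) =
    evaluate-operand succR p refl (#⁻¹-↠ r) ◅◅ succN (slot-update R i p) (#⁻¹# _) ◅ ε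

  select : 𝔸 → 𝔸 → ℕ → 𝔸
  select b c zero = b
  select b c (suc _) = c

  Ifz-steps : ∀ {R i j k l A T a b c m} → slot R i ≡ just a →
    slot (R [ i ≔ just (nm m) ]) j ≡ just b → slot (R [ i ≔ just (nm m) ]) k ≡ just c → a ↠ nm m →
    ⟨ R , act (Ifz i j k l A) , T ⟩ ↠ᶜ
    ⟨ (R [ i ≔ just (nm m) ]) [ l ≔ just (select b c m) ] , act A , T ⟩
  Ifz-steps {R} {i} {m = zero} p q r s =
    evaluate-operand ifzR p refl (#⁻¹-↠ s) ◅◅ ifz0 (slot-update R i p) (#⁻¹# _) q ◅ ε
  Ifz-steps {R} {i} {m = suc m} p q r s =
    evaluate-operand ifzR p refl (#⁻¹-↠ s) ◅◅ ifzS (slot-update R i p) (#⁻¹# _) r ◅ ε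

  RegTyp⇒RegsTy : ∀ {Δ ρ} → RegTyp machines Δ ρ → RegsTy tbl Δ ρ
  RegTyp⇒RegsTy [] = []
  RegTyp⇒RegsTy (empty ts) = ∅∷ RegTyp⇒RegsTy ts
  RegTyp⇒RegsTy (entry t ts) = t ∷ᵗ RegTyp⇒RegsTy ts

  nm-Typ-# : ∀ {n} → 𝒟 tbl int (nm n)
  nm-Typ-# {n} = nm-Typ {n}

  select-Typ : ∀ {b c} m → 𝒟 tbl int b → 𝒟 tbl int c → 𝒟 tbl int (select b c m)
  select-Typ zero tb tc = tb
  select-Typ (suc _) tb tc = tc

  tests-strict-# : ∀ {i B R T a k n} → TestsRegister i B → slot R i ≡ just a →
    # ⟨ R , act B , [] ⟩ ∙ T ⟶⟨ k ⟩ nm n → ∃₂ λ l m → l ≤ k × a ⟶⟨ l ⟩ nm m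
  tests-strict-# {i} {B} {R} {T} h u r
    with l , m , l≤k , r′ ← tests-strict {i} {B} h u (lower {⟨ R , act B , [] ⟩} {T} r) =
    l , m , l≤k , raise r′

  machineProgs : ProgModel tbl machines
  machineProgs = record
    { ⟦_⟧ᴾ = λ {Δ} {P} _ ρ → # ⟨ ρ , P , [] ⟩
    ; ⟦_⟧ᴬ = λ {Δ} {A} _ ρ → # ⟨ ρ , act A , [] ⟩
    ; ᴾ-Typ = λ d ts → subst (_∶ _) (sym (#⁻¹# _)) (tMach {τs = []} (RegTyp⇒RegsTy ts) d [])
    ; load-step = λ {Δ} {i} {P} {ρ = ρ} {a} d _ _ →
        subst (_↠ # ⟨ ρ [ i ≔ just a ] , P , [] ⟩)
          (sym (#-∙ ⟨ ρ , Load i P , [] ⟩ (a ∷ []))) (#-↠ (load ◅ ε))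
    ; act-step = λ _ → ε
    ; call-step = λ _ u → subst (_ ↠_) (##⁻¹ _) (#-↠ (call-identity u ◅ ε))
    ; app-step = λ _ _ _ _ u u′ _ _ → #-↠ (app u u′ ◅ ε)
    -- A machine overwrites the tested register, so only the numeral found matters, not the content
    -- that produced it.
    ; operand = λ _ → nm
    ; predecessor = λ _ m → nm (m ∸ 1)
    ; successor = λ _ m → nm (suc m)
    ; branch = λ _ → select
    ; operand-Typ = λ {_} {m} _ → nm-Typ-# {m}
    ; predecessor-Typ = λ {_} {m} _ → nm-Typ-# {m ∸ 1}
    ; successor-Typ = λ {_} {m} _ → nm-Typ-# {suc m}
    ; branch-Typ = λ {m = m} _ → select-Typ m
    ; operand-value = λ _ → ε
    ; predecessor-value = λ _ → ε
    ; successor-value = λ _ → ε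
    ; branch-zero = λ _ → ε
    ; branch-suc = λ _ → ε
    ; pred-step = λ {T = T} _ _ _ _ u _ r → ∙-steps T (#-↠ (Pred-steps u r))
    ; pred-strict = λ {Δ} {i} {j} {A} {T = T} _ _ _ _ u _ →
        tests-strict-# {B = Pred i j A} {T = T} Pred-tests u
    ; succ-step = λ {T = T} _ _ _ _ u _ r → ∙-steps T (#-↠ (Succ-steps u r))
    ; succ-strict = λ {Δ} {i} {j} {A} {T = T} _ _ _ _ u _ →
        tests-strict-# {B = Succ i j A} {T = T} Succ-tests u
    ; ifz-step = λ {T = T} _ _ _ _ _ _ u u₀ u₁ _ r → ∙-steps T (#-↠ (Ifz-steps u u₀ u₁ r))
    ; ifz-strict = λ {Δ} {i} {j} {k} {l} {A} {T = T} _ _ _ _ _ _ u _ →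
        tests-strict-# {B = Ifz i j k l A} {T = T} Ifz-tests u
    ; fixpoint = λ _ → y
    ; fixpoint-Typ = y-Typ
    ; fixpoint-step = λ _ → ε
    }

  -- Adequacy of the translation

  lastIndex-snoc : ∀ xs z x →
    lastIndex tbl (xs ++ (z ∷ [])) x ≡ (if x ≡ᵇ z then just (length xs) else lastIndex tbl xs x)
  lastIndex-snoc [] z x = refl
  lastIndex-snoc (w ∷ xs) z x with lastIndex tbl (xs ++ (z ∷ [])) x | lastIndex-snoc xs z x
  ... | i | eq with x ≡ᵇ z
  lastIndex-snoc (w ∷ xs) z x | _ | refl | true = refl
  lastIndex-snoc (w ∷ xs) z x | _ | refl | false = refl

  -- The innermost binding is the first one in `γ` and the last one in `names γ`, so both searches
  -- resolve shadowing alike.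
  lookup-lastIndex : ∀ {A : Set} (γ : List (ℕ × A)) {x a} → lookup γ x ≡ just a →
    ∃ λ i → lastIndex tbl (names γ) x ≡ just i × values γ ‼ i ≡ just a
  lookup-lastIndex ((z , b) ∷ γ) {x} eq with x ≡ᵇ z | lastIndex-snoc (names γ) z x
  lookup-lastIndex ((z , b) ∷ γ) refl | true | eq′ = _ , trans eq′ (cong just (length-names γ)) ,
    ‼-snoc (values γ)
  ... | false | eq′ with lookup-lastIndex γ eq
  ... | i , p , q = i , trans eq′ p , ‼-++ (values γ) q

  loads-steps : ∀ {R b n A} as → n ≡ length as →
    ⟨ R , loads tbl (range b n) A , as ⟩ ↠ᶜ ⟨ fill R b as , act A , [] ⟩
  loads-steps [] refl = ε
  loads-steps (a ∷ as) refl = load ◅ loads-steps as refl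

  recast : ∀ {M R R′ P T} → R ≡ R′ → M ↠ᶜ ⟨ R , P , T ⟩ → M ↠ᶜ ⟨ R′ , P , T ⟩
  recast refl r = r

  apps-steps : ∀ {R b r n A a as} → n ≡ length as → slot R r ≡ just a → Slots R b as → r < b →
    ⟨ R , act (apps tbl r (range b n) A) , [] ⟩ ↠ᶜ ⟨ R [ r ≔ just (a ∙ as) ] , act A , [] ⟩
  apps-steps {R} {r = r} refl p [] r<b rewrite update-slot R r p = ε
  apps-steps {R} {r = r} {A = A} refl p (q ∷ qs) r<b =
    app p q ◅ recast (update-update R r)
      (apps-steps refl (slot-update R r p) (Slots-update (m<n⇒m<1+n r<b) qs) (m<n⇒m<1+n r<b))

  loads-⊢ : ∀ {Δ b n A α} τs → n ≡ length τs → _⊢ᴬ_∶_ tbl (fill Δ b τs) A α →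
    _⊢ᴾ_∶_ tbl Δ (loads tbl (range b n) A) (τs ⇛ α)
  loads-⊢ [] refl t = tAct t
  loads-⊢ (τ ∷ τs) refl t = tLoad (loads-⊢ τs refl t)

  apps-⊢ : ∀ {Δ b r n A α β τs} → n ≡ length τs → slot Δ r ≡ just (τs ⇛ β) → Slots Δ b τs →
    r < b → _⊢ᴬ_∶_ tbl (Δ [ r ≔ just β ]) A α → _⊢ᴬ_∶_ tbl Δ (apps tbl r (range b n) A) α
  apps-⊢ {Δ} {r = r} refl p [] r<b t = subst (λ Δ → _⊢ᴬ_∶_ tbl Δ _ _) (update-slot Δ r p) t
  apps-⊢ {Δ} {r = r} refl p (q ∷ qs) r<b t = tApp p q
    (apps-⊢ refl (slot-update Δ r p) (Slots-update (m<n⇒m<1+n r<b) qs) (m<n⇒m<1+n r<b)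
      (subst (λ Δ → _⊢ᴬ_∶_ tbl Δ _ _) (sym (update-update Δ r)) t))

  -- The pattern shared by the clauses of `Tr` for application, `pred`, `succ` and `ifz`:
  -- consecutive registers hold translated subterms, each to be applied to the whole environment.
  -- The clause for `fix` is handled apart, since there register 0 holds `y` and is not applied to
  -- the environment.
  applyAll : ℕ → ℕ → List ℕ → Act → Act
  applyAll r zero is B = B
  applyAll r (suc c) is B = apps tbl r is (applyAll (suc r) c is B)

  applyAll-steps : ∀ {R b r n B as} ms → n ≡ length as → Slots R r ms → Slots R b as →
    r + length ms ≤ b →
    ⟨ R , act (applyAll r (length ms) (range b n) B) , [] ⟩ ↠ᶜ
    ⟨ fill R r (map (_∙ as) ms) , act B , [] ⟩
  applyAll-steps [] e [] qs le = ε
  applyAll-steps {b = b} {r} (m ∷ ms) e (p ∷ ps) qs le =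
    apps-steps e p qs r<b ◅◅
    applyAll-steps ms e (Slots-update ≤-refl ps) (Slots-update r<b qs) le′
    where
    le′ : suc r + length ms ≤ b
    le′ = subst (_≤ b) (+-suc r (length ms)) le
    r<b : r < b
    r<b = ≤-trans (s≤s (m≤m+n r (length ms))) le′

  applyAll-⊢ : ∀ {Δ b r n B α τs} σs → n ≡ length τs → Slots Δ r (map (τs ⇛_) σs) →
    Slots Δ b τs → r + length σs ≤ b → _⊢ᴬ_∶_ tbl (fill Δ r σs) B α →
    _⊢ᴬ_∶_ tbl Δ (applyAll r (length σs) (range b n) B) α
  applyAll-⊢ [] e [] qs le t = t
  applyAll-⊢ {b = b} {r} (σ ∷ σs) e (p ∷ ps) qs le t =
    apps-⊢ e p qs r<b (applyAll-⊢ σs e (Slots-update ≤-refl ps) (Slots-update r<b qs) le′ t)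
    where
    le′ : suc r + length σs ≤ b
    le′ = subst (_≤ b) (+-suc r (length σs)) le
    r<b : r < b
    r<b = ≤-trans (s≤s (m≤m+n r (length σs))) le′

  -- Unfolds to the very registers written out in `Tr`, so that `setup` fits those clauses without a
  -- cast.
  frame : ∀ {A : Set} → List A → ℕ → List (Maybe A)
  frame [] n = replicate n nothing
  frame (a ∷ pre) n = just a ∷ frame pre n

  length-frame : ∀ {A : Set} (pre : List A) n → length (frame pre n) ≡ length pre + n
  length-frame [] n = length-replicate n
  length-frame (_ ∷ pre) n = cong suc (length-frame pre n)

  slot-frame : ∀ {A : Set} pre {n i} {a : A} → pre ‼ i ≡ just a → slot (frame pre n) i ≡ just a
  slot-frame (_ ∷ pre) {i = zero} p = p
  slot-frame (_ ∷ pre) {i = suc i} p = slot-frame pre p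

  module _ {A : Set} (pre : List A) {n} (as : List A) (eq : n ≡ length as) where
    filled : List (Maybe A)
    filled = fill (frame pre n) (length pre) as

    length-filled : length filled ≡ length pre + length as
    length-filled = trans (length-fill (frame pre n) as)
      (trans (length-frame pre n) (cong (length pre +_) eq))

    filled-Slots : Slots filled (length pre) as
    filled-Slots = fill-Slots as
      (≤-reflexive (trans (cong (length pre +_) (sym eq)) (sym (length-frame pre n))))

    filled-‼ : ∀ {i a} → i < length pre → pre ‼ i ≡ just a → slot filled i ≡ just a
    filled-‼ i<l p = trans (slot-fill-< as i<l) (slot-frame pre p)

    filled-Slots-pre : Slots filled 0 pre
    filled-Slots-pre = ‼-Slots pre λ p → filled-‼ (‼⇒< pre p) p

  setup : ∀ {n B} ms as → n ≡ length as → ∃ λ R →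
    (⟨ frame ms n ,
       loads tbl (range (length ms) n) (applyAll 0 (length ms) (range (length ms) n) B) , as ⟩ ↠ᶜ
     ⟨ R , act B , [] ⟩) ×
    Slots R 0 (map (_∙ as) ms)
  setup ms as e = _ ,
    (loads-steps as e ◅◅
     applyAll-steps ms e (filled-Slots-pre ms as e) (filled-Slots ms as e) ≤-refl) ,
    fill-Slots (map (_∙ as) ms) (subst₂ _≤_ (sym (length-map (_∙ as) ms))
      (sym (length-filled ms as e)) (m≤m+n _ _))

  setup-⊢ : ∀ {n B α} σs τs → n ≡ length τs →
    (∀ {Δ} → Slots Δ 0 σs → _⊢ᴬ_∶_ tbl Δ B α) →
    _⊢ᴾ_∶_ tbl (frame (map (τs ⇛_) σs) n)
      (loads tbl (range (length (map (τs ⇛_) σs)) n)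
        (applyAll 0 (length σs) (range (length (map (τs ⇛_) σs)) n) B))
      (τs ⇛ α)
  setup-⊢ σs τs e t = loads-⊢ τs e (applyAll-⊢ σs e (filled-Slots-pre pre τs e)
    (filled-Slots pre τs e) (≤-reflexive (sym (length-map (τs ⇛_) σs)))
    (t (fill-Slots σs (subst₂ _≤_ (length-map (τs ⇛_) σs) (sym (length-filled pre τs e))
      (m≤m+n _ _)))))
    where
    pre : List Ty
    pre = map (τs ⇛_) σs

  empties-Ty : ∀ n → RegsTy tbl (replicate n nothing) (empties tbl n)
  empties-Ty zero = []
  empties-Ty (suc n) = ∅∷ empties-Ty n

  machineTr : Term → List (ℕ × 𝔸) → 𝔸
  machineTr M γ = # (Tr tbl (names γ) M) ∙ values γ

  Tr-Typ : ∀ {Γ M α} → Γ ⊢ M ∶ α → Tr tbl (names Γ) M ∶ (values Γ ⇛ α)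

  #Tr-Typ : ∀ {Γ M α} → Γ ⊢ M ∶ α → 𝒟 tbl (values Γ ⇛ α) (# (Tr tbl (names Γ) M))
  #Tr-Typ t = subst (_∶ _) (sym (#⁻¹# _)) (Tr-Typ t)

  Tr-Typ {Γ} (tvar {x = x} eq)
    with lookup-lastIndex Γ (trans (sym (lookupT≡lookup Γ x)) eq)
  ... | i , p , q rewrite p = tMach {τs = []} (empties-Ty _)
    (loads-⊢ (values Γ) (length-names Γ)
      (tCall (Slots-‼ (filled-Slots [] (values Γ) (length-names Γ)) q))) []
  Tr-Typ {Γ} (tlam t) = subst (_ ∶_) (⇛-++ (values Γ)) (Tr-Typ t)
  Tr-Typ {Γ} (tapp {σ = σ} {τ} t u) = tMach {τs = []}
    (#Tr-Typ t ∷ᵗ (#Tr-Typ u ∷ᵗ empties-Ty _))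
    (setup-⊢ ((σ ⇒ τ) ∷ σ ∷ []) (values Γ) (length-names Γ) λ { {Δ} (p ∷ q ∷ []) →
      tApp p q (tCall (slot-update Δ 0 p)) }) []
  Tr-Typ {Γ} (tnum {n = n}) = tMach {τs = []}
    (subst (_∶ int) (trans (sym (#⁻¹# _)) (cong #⁻¹ (#num n))) tNum ∷ᵗ empties-Ty _)
    (loads-⊢ (values Γ) (length-names Γ)
      (tCall (filled-‼ (int ∷ []) (values Γ) (length-names Γ) (s≤s z≤n) refl))) []
  Tr-Typ {Γ} (tpred t) = tMach {τs = []} (#Tr-Typ t ∷ᵗ empties-Ty _)
    (setup-⊢ (int ∷ []) (values Γ) (length-names Γ) λ { {Δ} (p ∷ []) →
      tPred p (tCall (slot-update Δ 0 p)) }) []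
  Tr-Typ {Γ} (tsucc t) = tMach {τs = []} (#Tr-Typ t ∷ᵗ empties-Ty _)
    (setup-⊢ (int ∷ []) (values Γ) (length-names Γ) λ { {Δ} (p ∷ []) →
      tSucc p (tCall (slot-update Δ 0 p)) }) []
  Tr-Typ {Γ} (tifz t u v) = tMach {τs = []}
    (#Tr-Typ t ∷ᵗ (#Tr-Typ u ∷ᵗ (#Tr-Typ v ∷ᵗ empties-Ty _)))
    (setup-⊢ (int ∷ int ∷ int ∷ []) (values Γ) (length-names Γ) λ { {Δ} (p ∷ q ∷ r ∷ []) →
      tIfz p q r (tCall (slot-update Δ 0 p)) }) []
  Tr-Typ {Γ} (tfix {α = α} t) = tMach {τs = []}
    (y-Typ ∷ᵗ (#Tr-Typ t ∷ᵗ empties-Ty _))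
    (loads-⊢ τs e (apps-⊢ e
      (filled-‼ pre τs e (s≤s (s≤s z≤n)) refl) (filled-Slots pre τs e) (s≤s (s≤s z≤n))
      (tApp p (slot-update Δ 1 (filled-‼ pre τs e (s≤s (s≤s z≤n)) refl))
        (tCall (slot-update (Δ [ 1 ≔ _ ]) 0 p))))) []
    where
    τs = values Γ
    e = length-names Γ
    pre : List Ty
    pre = ((α ⇒ α) ⇒ α) ∷ (τs ⇛ (α ⇒ α)) ∷ []
    Δ = filled pre τs e
    p : slot (Δ [ 1 ≔ just (α ⇒ α) ]) 0 ≡ just ((α ⇒ α) ⇒ α)
    p = trans (slot-update-≢ Δ 1 0 λ ()) (filled-‼ pre τs e (s≤s z≤n) refl)

  run : ∀ {M T N} → M ⊲ T ↠ᶜ N → # M ∙ T ↠ # N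
  run {M} {T} {N} r = subst (_↠ # N) (sym (#-∙ M T)) (#-↠ r)

  run-call : ∀ {M T a} → M ⊲ T ↠ᶜ #⁻¹ a → # M ∙ T ↠ a
  run-call {M} {T} r = subst (# M ∙ T ↠_) (##⁻¹ _) (run {M} r)

  ∙-snoc : ∀ {a b} T → (a ∙ T) ⊙ b ≡ a ∙ (T ++ (b ∷ []))
  ∙-snoc [] = refl
  ∙-snoc (_ ∷ T) = ∙-snoc T

  ∙-Typ : ∀ {τs T α a} → 𝒟 tbl (τs ⇛ α) a → TapeTy tbl T τs → 𝒟 tbl α (a ∙ T)
  ∙-Typ D [] = D
  ∙-Typ D (E ∷ ts) = ∙-Typ (·ᴬ-Typ D E) ts

  values-Typ : ∀ {Γ γ} → CtxTyp machines Γ γ → TapeTy tbl (values γ) (values Γ)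
  values-Typ [] = []
  values-Typ (t ∷ c) = TapeTy-++ (values-Typ c) (t ∷ [])

  names-≡ : ∀ {Γ γ} → CtxTyp machines Γ γ → names Γ ≡ names γ
  names-≡ [] = refl
  names-≡ (_ ∷ c) = cong (_++ _) (names-≡ c)

  machineTr-Typ : ∀ {Γ γ M α} → CtxTyp machines Γ γ → Γ ⊢ M ∶ α → 𝒟 tbl α (machineTr M γ)
  machineTr-Typ {M = M} c t rewrite sym (names-≡ c) = ∙-Typ (#Tr-Typ t) (values-Typ c)

  machineTr-var : ∀ γ {x a} → lookup γ x ≡ just a → machineTr (var x) γ ↠ a
  machineTr-var γ {x} eq with lookup-lastIndex γ eq
  ... | i , p , q rewrite p = run-call {⟨ empties tbl _ , _ , [] ⟩}
    (loads-steps (values γ) (length-names γ) ◅◅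
    call-identity (Slots-‼ (filled-Slots [] (values γ) (length-names γ)) q) ◅ ε)

  -- An equation, not a reduction: abstraction is translated as its body with one more variable, and
  -- the argument simply joins the tape.
  machineTr-lam : ∀ γ x σ M a → machineTr (lam x σ M) γ ⊙ a ≡ machineTr M ((x , a) ∷ γ)
  machineTr-lam γ x σ M a = ∙-snoc (values γ)

  machineTr-app : ∀ γ M N → machineTr (M · N) γ ↠ machineTr M γ ⊙ machineTr N γ
  machineTr-app γ M N
    with R , r , p ∷ q ∷ [] ← setup (# (Tr tbl (names γ) M) ∷ # (Tr tbl (names γ) N) ∷ [])
           (values γ) (length-names γ) =
    run-call {Tr tbl (names γ) (M · N)}
      (r ◅◅ app p q ◅ call-identity (slot-update R 0 p) ◅ ε)

  machineTr-num : ∀ γ n → machineTr (num n) γ ↠ nm n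
  machineTr-num γ n rewrite #num n =
    run-call {Tr tbl (names γ) (num n)} (loads-steps (values γ) (length-names γ) ◅◅
      call-identity (filled-‼ (num𝔸 n ∷ []) (values γ) (length-names γ) (s≤s z≤n) refl) ◅ ε)

  machineTr-fix : ∀ γ M → machineTr (fix M) γ ↠ y ⊙ machineTr M γ
  machineTr-fix γ M = run-call {Tr tbl (names γ) (fix M)} (loads-steps as e ◅◅
    apps-steps e (filled-‼ pre as e (s≤s (s≤s z≤n)) refl) (filled-Slots pre as e)
      (s≤s (s≤s z≤n)) ◅◅
    app p (slot-update R 1 (filled-‼ pre as e (s≤s (s≤s z≤n)) refl)) ◅
    call-identity (slot-update (R [ 1 ≔ _ ]) 0 p) ◅ ε)
    where
    as = values γ
    e = length-names γ
    pre : List 𝔸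
    pre = y ∷ # (Tr tbl (names γ) M) ∷ []
    R = filled pre as e
    p : slot (R [ 1 ≔ just (machineTr M γ) ]) 0 ≡ just y
    p = trans (slot-update-≢ R 1 0 λ ()) (filled-‼ pre as e (s≤s z≤n) refl)

  machineTerms : TermModel machines
  machineTerms = record
    { sem = machineTr
    ; sem-Typ = machineTr-Typ
    ; sem-var = λ {γ = γ} _ → machineTr-var γ
    ; sem-lam = λ {Γ} {γ} {x} {σ} {M} {a = a} _ _ _ →
        subst (_↠ machineTr M ((x , a) ∷ γ)) (sym (machineTr-lam γ x σ M a)) ε
    ; sem-app = λ {Γ} {γ} {M} {N} _ → machineTr-app γ M N
    ; sem-num = λ {Γ} {γ} {n} _ → machineTr-num γ n
    ; sem-pred = λ {Γ} {γ} {M} _ r →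
        let R , s , p = testSetup γ M (Pred 0 0 (Call 0))
        in run-call {Tr tbl (names γ) (pred M)} (s ◅◅ Pred-steps p r ◅◅
             call-identity (slot-update (R [ 0 ≔ _ ]) 0 (slot-update R 0 p)) ◅ ε)
    ; sem-succ = λ {Γ} {γ} {M} _ r →
        let R , s , p = testSetup γ M (Succ 0 0 (Call 0))
        in run-call {Tr tbl (names γ) (succ M)} (s ◅◅ Succ-steps p r ◅◅
             call-identity (slot-update (R [ 0 ≔ _ ]) 0 (slot-update R 0 p)) ◅ ε)
    ; sem-ifz0 = λ {Γ} {γ} {L} {M} {N} _ r →
        let R , s , p , q , q′ = ifzSetup γ L M N
        in run-call {Tr tbl (names γ) (ifz L M N)} (s ◅◅ Ifz-steps p
             (trans (slot-update-≢ R 0 1 λ ()) q) (trans (slot-update-≢ R 0 2 λ ()) q′) r ◅◅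
             call-identity (slot-update (R [ 0 ≔ _ ]) 0 (slot-update R 0 p)) ◅ ε)
    ; sem-ifzS = λ {Γ} {γ} {L} {M} {N} _ r →
        let R , s , p , q , q′ = ifzSetup γ L M N
        in run-call {Tr tbl (names γ) (ifz L M N)} (s ◅◅ Ifz-steps p
             (trans (slot-update-≢ R 0 1 λ ()) q) (trans (slot-update-≢ R 0 2 λ ()) q′) r ◅◅
             call-identity (slot-update (R [ 0 ≔ _ ]) 0 (slot-update R 0 p)) ◅ ε)
    ; sem-fix = λ {Γ} {γ} {M} _ → machineTr-fix γ M
    ; pred-strict = λ {Γ} {γ} {M} _ r →
        let R , s , p = testSetup γ M (Pred 0 0 (Call 0))
        in strict-after (Pred 0 0 (Call 0)) Pred-tests p (run {Tr tbl (names γ) (pred M)} s) r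
    ; succ-strict = λ {Γ} {γ} {M} _ r →
        let R , s , p = testSetup γ M (Succ 0 0 (Call 0))
        in strict-after (Succ 0 0 (Call 0)) Succ-tests p (run {Tr tbl (names γ) (succ M)} s) r
    ; ifz-strict = λ {Γ} {γ} {L} {M} {N} _ r →
        let R , s , p , _ = ifzSetup γ L M N
        in strict-after (Ifz 0 1 2 0 (Call 0)) Ifz-tests p
             (run {Tr tbl (names γ) (ifz L M N)} s) r
    }
    where
    testSetup : ∀ γ M B → ∃ λ R →
      (⟨ frame (# (Tr tbl (names γ) M) ∷ []) (length (names γ)) ,
         loads tbl (range 1 (length (names γ))) (apps tbl 0 (range 1 (length (names γ))) B) ,
         values γ ⟩ ↠ᶜ ⟨ R , act B , [] ⟩) ×
      slot R 0 ≡ just (machineTr M γ)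
    testSetup γ M B with R , r , p ∷ [] ← setup {B = B} (# (Tr tbl (names γ) M) ∷ [])
      (values γ) (length-names γ) = R , r , p

    ifzSetup : ∀ γ L M N → ∃ λ R →
      (Tr tbl (names γ) (ifz L M N) ⊲ values γ ↠ᶜ ⟨ R , act (Ifz 0 1 2 0 (Call 0)) , [] ⟩) ×
      slot R 0 ≡ just (machineTr L γ) × slot R 1 ≡ just (machineTr M γ) ×
      slot R 2 ≡ just (machineTr N γ)
    ifzSetup γ L M N with R , r , p ∷ q ∷ q′ ∷ [] ←
      setup (# (Tr tbl (names γ) L) ∷ # (Tr tbl (names γ) M) ∷ # (Tr tbl (names γ) N) ∷ [])
        (values γ) (length-names γ) = R , r , p , q , q′

    strict-after : ∀ {x R a k n} B → TestsRegister 0 B → slot R 0 ≡ just a →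
      x ↠ # ⟨ R , act B , [] ⟩ → x ⟶⟨ k ⟩ nm n → ∃₂ λ l m → l ≤ k × a ⟶⟨ l ⟩ nm m
    strict-after B h p s r with advance r s
    ... | k′ , k′≤k , r′ with tests-strict-# {B = B} {T = []} h p r′
    ... | l , m , l≤k′ , r″ = l , m , ≤-trans l≤k′ k′≤k , r″

  -- Full abstraction

  private
    module MachineProgs = ProgModel machineProgs
    module PCFProgs = ProgModel (pcfProgs tbl)
    module MM = LogicalRelation machines machines
    module MP = LogicalRelation machines pcf
    module PM = LogicalRelation pcf machines

  mutual
    -- On the machine side the reading of a derivation reassembles the machine, so `ᴹ-Rel` becomes a
    -- statement about the given address.
    ⟦⟧ᴹ-# : ∀ {M α} (D : M ∶ α) → MachineProgs.⟦ D ⟧ᴹ ≡ # M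
    ⟦⟧ᴹ-# tNum = refl
    ⟦⟧ᴹ-# (tMach {R} {P} {T} rs d ts) rewrite ⟦⟧ᴿ-# rs | ⟦⟧ᵀ-# ts = #-∙ ⟨ R , P , [] ⟩ T
    ⟦⟧ᴹ-# (tY {T} _ ts) rewrite ⟦⟧ᵀ-# ts = trans (∙-⊲ y T) (cong (λ M → # (M ⊲ T)) #⁻¹y)

    ⟦⟧ᴿ-# : ∀ {Δ R} (rs : RegsTy tbl Δ R) → MachineProgs.⟦ rs ⟧ᴿ ≡ R
    ⟦⟧ᴿ-# [] = refl
    ⟦⟧ᴿ-# (∅∷ rs) = cong (nothing ∷_) (⟦⟧ᴿ-# rs)
    ⟦⟧ᴿ-# (D ∷ᵗ rs) = cong₂ (λ a R → just a ∷ R) (trans (⟦⟧ᴹ-# D) (##⁻¹ _)) (⟦⟧ᴿ-# rs)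

    ⟦⟧ᵀ-# : ∀ {T τs} (ts : TapeTy tbl T τs) → MachineProgs.⟦ ts ⟧ᵀ ≡ T
    ⟦⟧ᵀ-# [] = refl
    ⟦⟧ᵀ-# (D ∷ ts) = cong₂ _∷_ (trans (⟦⟧ᴹ-# D) (##⁻¹ _)) (⟦⟧ᵀ-# ts)

  infix 4 _≃⟨_⟩_
  _≃⟨_⟩_ : 𝔸 → Ty → 𝔸 → Set
  a ≃⟨ α ⟩ b = _≃[_]_ tbl a α b

  ⟦⟧ᴹ-𝒟 : ∀ {α a} (D : 𝒟 tbl α a) → MachineProgs.⟦ D ⟧ᴹ ≡ a
  ⟦⟧ᴹ-𝒟 D = trans (⟦⟧ᴹ-# D) (##⁻¹ _)

  Rel-refl : ∀ {k α a} → 𝒟 tbl α a → MM.Rel k α a a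
  Rel-refl {k} {α} D =
    subst (λ a → MM.Rel k α a a) (⟦⟧ᴹ-𝒟 D) (ᴹ-Rel machineProgs machineProgs D)

  -- The second premise is required at every index because the first gives no bound on the number of
  -- steps that `b` takes. At arrow type it is used on the diagonal, with the right-hand argument
  -- related to itself.
  Rel-trans : ∀ α {k a b c} → MM.Rel k α a b → (∀ i → MM.Rel i α b c) → MM.Rel k α a c
  Rel-trans int r r′ j<k s = let i , s′ = Star⇒Iter (r j<k s) in r′ (suc i) ≤-refl s′
  Rel-trans (α ⇒ β) r r′ j≤k ta tb rab = Rel-trans β (r j≤k ta tb rab)
    λ i → r′ i ≤-refl tb tb (Rel-refl tb)

  ≡ᴹ-app : ∀ {β a b c d} → a ⊙ c ≃⟨ β ⟩ b ⊙ d →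
    _≡[_]_ tbl (#⁻¹ a ⊲ (c ∷ [])) β (#⁻¹ b ⊲ (d ∷ []))
  ≡ᴹ-app {β} = subst₂ (λ M N → _≡[_]_ tbl M β N) (#⁻¹# _) (#⁻¹# _)

  ≃-app : ∀ {β a b c d} → _≡[_]_ tbl (#⁻¹ a ⊲ (c ∷ [])) β (#⁻¹ b ⊲ (d ∷ [])) →
    a ⊙ c ≃⟨ β ⟩ b ⊙ d
  ≃-app {β} = subst₂ (λ M N → _≡[_]_ tbl M β N) (sym (#⁻¹# _)) (sym (#⁻¹# _))

  -- On typed machines ≃ coincides with the ω-limit of Rel in both directions: since typed machines
  -- are Rel-related to themselves, arguments related up to step j may be exchanged on one side.
  mutual
    ≃⇒Rel : ∀ α {a b} → 𝒟 tbl α a → 𝒟 tbl α b → a ≃⟨ α ⟩ b →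
      ∀ k → MM.Rel k α a b × MM.Rel k α b a
    ≃⇒Rel int ta tb e k =
      (λ _ s → #-steps (proj₁ (e _) (#⁻¹-↠ (Iter⇒Star s)))) ,
      (λ _ s → #-steps (proj₂ (e _) (#⁻¹-↠ (Iter⇒Star s))))
    ≃⇒Rel (α ⇒ β) ta tb e k =
      (λ _ tc td rcd → Rel-trans β (Rel-refl ta ≤-refl tc td rcd) λ i → proj₁ (at td i)) ,
      (λ _ tc td rcd → Rel-trans β (Rel-refl tb ≤-refl tc td rcd) λ i → proj₂ (at td i))
      where
      at : ∀ {d} → 𝒟 tbl α d → ∀ i → MM.Rel i β (_ ⊙ d) (_ ⊙ d) × MM.Rel i β (_ ⊙ d) (_ ⊙ d)
      at {d} td = ≃⇒Rel β (·ᴬ-Typ ta td) (·ᴬ-Typ tb td) (≃-app {β} (e d d td td (≃-refl td)))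

    Rel⇒≃ : ∀ α {a b} → 𝒟 tbl α a → 𝒟 tbl α b →
      (∀ k → MM.Rel k α a b) → (∀ k → MM.Rel k α b a) → a ≃⟨ α ⟩ b
    Rel⇒≃ int ta tb r r′ n =
      (λ s → let k , s′ = Star⇒Iter (#-steps s) in #⁻¹-↠ (r (suc k) ≤-refl s′)) ,
      (λ s → let k , s′ = Star⇒Iter (#-steps s) in #⁻¹-↠ (r′ (suc k) ≤-refl s′))
    Rel⇒≃ (α ⇒ β) ta tb r r′ c d tc td e = ≡ᴹ-app {β} (Rel⇒≃ β (·ᴬ-Typ ta tc) (·ᴬ-Typ tb td)
      (λ k → r k ≤-refl tc td (proj₁ (≃⇒Rel α tc td e k)))
      (λ k → r′ k ≤-refl td tc (proj₂ (≃⇒Rel α tc td e k))))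

    ≃-refl : ∀ {α a} → 𝒟 tbl α a → a ≃⟨ α ⟩ a
    ≃-refl {α} D = Rel⇒≃ α D D (λ _ → Rel-refl D) (λ _ → Rel-refl D)

  -- At arrow type the middle point is `M` applied to `b`, which takes reflexivity of `≃` at the
  -- typed address `b`.
  ≡ᴹ-trans : ∀ α {L M N} → _≡[_]_ tbl L α M → _≡[_]_ tbl M α N → _≡[_]_ tbl L α N
  ≡ᴹ-trans int e e′ n = proj₁ (e′ n) ∘ proj₁ (e n) , proj₂ (e n) ∘ proj₂ (e′ n)
  ≡ᴹ-trans (α ⇒ β) e e′ a b ta tb eab =
    ≡ᴹ-trans β (e a b ta tb eab) (e′ b b tb tb (≃-refl tb))

  -- Definability and the two implications

  record Realises (α : Ty) (a : 𝔸) (Q : Term) : Set where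
    field
      machine-Typ : 𝒟 tbl α a
      term-Typ    : [] ⊢ Q ∶ α
      machine⇒term : ∀ k → MP.Rel k α a Q
      term⇒machine : ∀ k → PM.Rel k α Q a

  open Realises

  Realises-app : ∀ {α β a b P Q} → Realises (α ⇒ β) a P → Realises α b Q →
    Realises β (a ⊙ b) (P · Q)
  Realises-app r s = record
    { machine-Typ = ·ᴬ-Typ (machine-Typ r) (machine-Typ s)
    ; term-Typ = tapp (term-Typ r) (term-Typ s)
    ; machine⇒term = λ k →
        machine⇒term r k ≤-refl (machine-Typ s) (term-Typ s) (machine⇒term s k)
    ; term⇒machine = λ k →
        term⇒machine r k ≤-refl (term-Typ s) (machine-Typ s) (term⇒machine s k)
    }

  Realises-int⇒ : ∀ {a Q n} → Realises int a Q → a ↠ nm n → Q ↠PCF num n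
  -- At `int` the relation covers runs strictly shorter than the index, hence `suc k`.
  Realises-int⇒ r s = let k , s′ = Star⇒Iter s in machine⇒term r (suc k) ≤-refl s′

  Realises-int⇐ : ∀ {a Q n} → Realises int a Q → Q ↠PCF num n → a ↠ nm n
  Realises-int⇐ r s = let k , s′ = Star⇒Iter s in term⇒machine r (suc k) ≤-refl s′

  definability : ∀ {α a} → 𝒟 tbl α a → ∃ λ Q → Realises α a Q
  definability {α} D = PCFProgs.⟦ D ⟧ᴹ , record
    { machine-Typ = D
    ; term-Typ = PCFProgs.ᴹ-Typ D
    ; machine⇒term = λ k →
        subst (λ a → MP.Rel k α a PCFProgs.⟦ D ⟧ᴹ) (⟦⟧ᴹ-𝒟 D) (ᴹ-Rel machineProgs (pcfProgs tbl) D)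
    ; term⇒machine = λ k →
        subst (λ a → PM.Rel k α PCFProgs.⟦ D ⟧ᴹ a) (⟦⟧ᴹ-𝒟 D) (ᴹ-Rel (pcfProgs tbl) machineProgs D)
    }

  Tr-realises : ∀ {α P} → [] ⊢ P ∶ α → Realises α (𝓘 tbl P) P
  Tr-realises {α} {P} t = record
    { machine-Typ = #Tr-Typ t
    ; term-Typ = t
    ; machine⇒term = λ k → subst (MP.Rel k α (𝓘 tbl P)) (⟪⟫-id λ _ → refl)
        (sem-Rel machineTerms pcfTerms [] t)
    ; term⇒machine = λ k → subst (λ Q → PM.Rel k α Q (𝓘 tbl P)) (⟪⟫-id {P} λ _ → refl)
        (sem-Rel pcfTerms machineTerms [] t)
    }

  -- Lets a context be treated as a function of its hole: `M` will be the context filled with the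
  -- variable `z`.
  Tr₁-realises : ∀ {α β z M a P} → ((z , α) ∷ []) ⊢ M ∶ β → Realises α a P →
    Realises β (# (Tr tbl (z ∷ []) M) ⊙ a) (M ⟪ lookup ((z , P) ∷ []) ⟫)
  Tr₁-realises t r = record
    { machine-Typ = ·ᴬ-Typ (#Tr-Typ t) (machine-Typ r)
    ; term-Typ = TermModel.sem-Typ pcfTerms (term-Typ r ∷ []) t
    ; machine⇒term = λ k → sem-Rel machineTerms pcfTerms
        (entry (machine-Typ r) (term-Typ r) (machine⇒term r k) []) t
    ; term⇒machine = λ k → sem-Rel pcfTerms machineTerms
        (entry (term-Typ r) (machine-Typ r) (term⇒machine r k) []) t
    }

  -- Stated for arbitrary realised pairs because at arrow type the induction meets `a ⊙ c` and
  -- `Q · N`, and `a ⊙ c` need not be the translation of a term. The term `N` realises `c` only; the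
  -- passage from `c` to the equivalent `d` is made inside `a′`, which respects `≃`.
  ≡obs⇒≃ : ∀ α {a a′ Q Q′} → Realises α a Q → Realises α a′ Q′ → Q ≡obs Q′ → a ≃⟨ α ⟩ a′
  ≡obs⇒≃ int {Q = Q} r r′ e n =
    (λ s → #⁻¹-↠ (Realises-int⇐ r′ (proj₁ e′ (Realises-int⇒ r (#-steps s))))) ,
    (λ s → #⁻¹-↠ (Realises-int⇐ r (proj₂ e′ (Realises-int⇒ r′ (#-steps s)))))
    where e′ = e hole (term-Typ r) (term-Typ r′) n
  ≡obs⇒≃ (α ⇒ β) r r′ e c d tc td ecd =
    let N , s = definability tc
    in ≡ᴹ-trans β
         (≡ᴹ-app {β} (≡obs⇒≃ β (Realises-app r s) (Realises-app r′ s) (≡obs-app e N)))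
         (≃-refl (machine-Typ r′) c d tc td ecd)

  ≃⇒≡obs : ∀ {α P P′} → [] ⊢ P ∶ α → [] ⊢ P′ ∶ α → 𝓘 tbl P ≃⟨ α ⟩ 𝓘 tbl P′ → P ≡obs P′
  ≃⇒≡obs {α} {P} {P′} t t′ e C tC tC′ n =
    (λ s → Realises-int⇒ r′ (#-steps (proj₁ (e′ n) (#⁻¹-↠ (Realises-int⇐ r s))))) ,
    (λ s → Realises-int⇒ r (#-steps (proj₂ (e′ n) (#⁻¹-↠ (Realises-int⇐ r′ s)))))
    where
    -- P is closed, so C[P] is C[z] with P substituted for a z that C does not bind.
    z : ℕ
    z = binderBound C
    F : Term
    F = plug C (var z)
    tF : ((z , α) ∷ []) ⊢ F ∶ int
    tF = plug-var-⊢ C (λ ()) lookup-z ≤-refl t tC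
      where
      lookup-z : lookupT ((z , α) ∷ []) z ≡ just α
      lookup-z rewrite ≡ᵇ-refl z = refl
    lookup-z : ∀ {P} → lookup ((z , P) ∷ []) z ≡ just P
    lookup-z rewrite ≡ᵇ-refl z = refl
    r : Realises int (# (Tr tbl (z ∷ []) F) ⊙ 𝓘 tbl P) (plug C P)
    r = subst (Realises int _) (plug-var-⟪⟫ C tC (λ ()) lookup-z ≤-refl)
      (Tr₁-realises tF (Tr-realises t))
    r′ : Realises int (# (Tr tbl (z ∷ []) F) ⊙ 𝓘 tbl P′) (plug C P′)
    r′ = subst (Realises int _) (plug-var-⟪⟫ C tC′ (λ ()) lookup-z ≤-refl)
      (Tr₁-realises tF (Tr-realises t′))
    e′ : # (Tr tbl (z ∷ []) F) ⊙ 𝓘 tbl P ≃⟨ int ⟩ # (Tr tbl (z ∷ []) F) ⊙ 𝓘 tbl P′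
    e′ = ≃-app {int} (≃-refl {α ⇒ int} (#Tr-Typ tF) _ _ (#Tr-Typ t) (#Tr-Typ t′) e)

theorem5p20 : ∀ {𝔸 : Set} {num𝔸 : ℕ → 𝔸} (tbl : AddressTable 𝔸 num𝔸) (α : Ty) (P P' : Term) →
    [] ⊢ P ∶ α → [] ⊢ P' ∶ α →
    ((_=[_]_ tbl (𝓘 tbl P) α (𝓘 tbl P') → P ≡obs P') × (P ≡obs P' → _=[_]_ tbl (𝓘 tbl P) α (𝓘 tbl P')))
theorem5p20 tbl α P P' t t' =
  ≃⇒≡obs t t' , ≡obs⇒≃ α (Tr-realises t) (Tr-realises t')
  where open Machines tbl
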